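{- Let $G$ be the complete graph on $\{0,\dots,n\}$ oriented by $i\to j$ iff $i<j$. For every spanning tree $T\in\mathbb{B}(G)$, $$p_{G\setminus T}=\sum_{s\in S_n}(-1)^{\operatorname{mm}(G\setminus T,\,s)}\,C(T,T_s)\,\mathbf{P}_s .$$
   Context: Polynomials are in variables $t=(t(1),\dots,t(n))$ with $t(0):=0$. To the edge of $G$ between $i<j$ associate $p_x(t)=t(j)-t(i)$; for a set $Y$ of edges oriented as in $G$, $p_Y:=\prod_{x\in Y}p_x$. $\mathbb{B}(G)$ is the set of spanning trees of $G$; $G\setminus T$ is the set of edges not in $T$. $S_n$ is the set of permutations of $\{1,\dots,n\}$, extended by $s(0):=0$. For $s\in S_n$, $G^s$ orients the edge $\{s(i),s(j)\}$, $i<j$, as $s(i)\to s(j)$. The path tree $T_s$ is the spanning tree with edges $\{s(k-1),s(k)\}$, $k=1,\dots,n$. $\mathbf{P}_s:=\prod(t(s(j))-t(s(i)))$ over all $0\le i<j\le n$ with $j\ne i+1$. For a set $Y$ of edges and $s\in S_n$, $\operatorname{mm}(Y,s)$ is the number of edges of $Y$ whose orientation in $G$ differs from their orientation in $G^s$ (i.e. edges $\{a,b\}$, $a<b$, with $s^{ -1}(a)>s^{ -1}(b)$). For $T\in\mathbb{B}(G)$: $i\prec_T j$ iff $i\neq j$ and the path in $T$ from $0$ to $j$ contains $i$; $T,T'$ are compatible if some total order on $\{0,\dots,n\}$ extends both $\prec_T$ and $\prec_{T'}$; $C(T,T')=1$ if compatible, $0$ otherwise. -}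

module Defs where

open import Algebra.Bundles using (CommutativeRing)
open import Algebra.Structures using (IsCommutativeRing)
import Algebra.Properties.CommutativeSemigroup as CommutativeSemigroupProperties
import Algebra.Properties.Ring as RingProperties
import Algebra.Properties.Semiring.Exp as Exp
open import Data.Bool.Base using (Bool; true; false; not; if_then_else_)
import Data.Bool.Properties as Bool
open import Data.Fin.Base using (Fin; zero; suc; toℕ; inject₁; _<_; punchIn; combine; remQuot)
import Data.Fin.Properties as Fin
open import Data.Fin.Permutation using (Permutation′; lift₀; insert; remove; insert-remove; insert-punchIn; _⟨$⟩ʳ_; _⟨$⟩ˡ_)
import Data.Fin.Permutation as Perm
open import Data.Fin.Subset.Properties using (anySubset?)
open import Data.List.Base using (List; []; _∷_; _++_; map; foldr; filter; length; lookup; concatMap; mapMaybe; allFin; cartesianProductWith)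
open import Data.List.Properties using (++-assoc; ++-identityʳ)
open import Data.List.Membership.Propositional using (_∈_; _∉_; lose)
open import Data.List.Membership.Propositional.Properties using (∈-allFin; ∈-lookup; ∈-concatMap⁺)
import Data.List.Membership.DecPropositional as DecMembership
open import Data.List.Relation.Unary.All using (All; []; _∷_)
import Data.List.Relation.Unary.All as All
import Data.List.Relation.Unary.All.Properties as All
open import Data.List.Relation.Unary.AllPairs using (AllPairs; []; _∷_)
import Data.List.Relation.Unary.AllPairs as AllPairs
import Data.List.Relation.Unary.AllPairs.Properties as AllPairs
open import Data.List.Relation.Unary.Any using (Any; here; there)
import Data.List.Relation.Unary.Any as Any
import Data.List.Relation.Unary.Any.Properties as Any
open import Data.List.Relation.Unary.Unique.Propositional using (Unique)
import Data.List.Relation.Unary.Unique.Propositional.Properties as Unique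
open import Data.Maybe.Base using (Maybe; just; nothing)
open import Data.Nat.Base as ℕ using (ℕ; zero; suc; z≤n; s≤s)
import Data.Nat.Properties as ℕ
open import Data.Product.Base using (Σ; ∃; ∃-syntax; _×_; _,_; proj₁; proj₂)
open import Data.Sum.Base using (_⊎_; inj₁; inj₂)
open import Data.Vec.Base as Vec using (Vec; []; _∷_)
import Data.Vec.Properties as Vec
open import Function.Base using (_∘_)
open import Level using (0ℓ)
open import Relation.Binary.Core using (Rel)
open import Relation.Binary.Definitions using (Decidable; Tri; tri<; tri≈; tri>)
open import Relation.Binary.Structures using (IsStrictTotalOrder)
open import Relation.Binary.PropositionalEquality using (_≡_; _≢_; refl; sym; trans; cong; cong₂; isEquivalence; resp₂)
import Relation.Binary.PropositionalEquality as ≡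
import Relation.Binary.Reasoning.Setoid as SetoidReasoning
open import Relation.Nullary.Decidable using (Dec; yes; no; does; map′; recompute; _×-dec_; _⊎-dec_; _→-dec_; ¬?)
open import Relation.Nullary.Negation using (¬_; contradiction)
import Relation.Unary as Unary

------------------------------------------------------------------------
-- The complete graph on {0,…,n}, its edge sets and its spanning trees

-- The vertices 0,…,n.
V : ℕ → Set
V n = Fin (suc n)

-- An edge of the complete graph, with its orientation tail → head.
record Edge (n : ℕ) : Set where
  constructor edge
  field
    tail head  : V n
    .tail<head : tail < head

open Edge public

edge? : ∀ {n} → V n → V n → Maybe (Edge n)
edge? i j with i Fin.<? j
... | yes i<j = just (edge i j i<j)
... | no  _   = nothing

-- Every edge, listed exactly once: edges-complete and edges-unique below.
edges : ∀ n → List (Edge n)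
edges n = concatMap (λ i → mapMaybe (edge? i) (allFin (suc n))) (allFin (suc n))

EdgeSet : ℕ → Set
EdgeSet n = Edge n → Bool

-- The complement G ∖ Y.
∁ : ∀ {n} → EdgeSet n → EdgeSet n
∁ Y = not ∘ Y

elements : ∀ {n} → EdgeSet n → List (Edge n)
elements {n} Y = filter (λ e → Y e Bool.≟ true) (edges n)

Joins : ∀ {n} → Edge n → V n → V n → Set
Joins e i j = (tail e ≡ i × head e ≡ j) ⊎ (tail e ≡ j × head e ≡ i)

module _ {n : ℕ} (Y : EdgeSet n) where

  Adjacent : V n → V n → Set
  Adjacent i j = ∃[ e ] Y e ≡ true × Joins e i j

  -- A path visits no vertex twice; the last index lists its vertices in order.
  data Path : V n → V n → List (V n) → Set where
    stop : ∀ {i} → Path i i (i ∷ [])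
    step : ∀ {i j k vs} → Adjacent i j → i ∉ vs → Path j k vs → Path i k (i ∷ vs)

  Connected : Set
  Connected = ∀ i j → ∃[ vs ] Path i j vs

  -- A cycle: a path on at least three vertices whose ends are adjacent.
  Cycle : Set
  Cycle = ∃[ i ] ∃[ j ] ∃[ vs ] Path i j vs × 3 ℕ.≤ length vs × Adjacent j i

  IsSpanningTree : Set
  IsSpanningTree = Connected × ¬ Cycle

  -- In a spanning tree the path from 0 to j is unique, so "some path" is
  -- "the path".
  Precedes : V n → V n → Set
  Precedes i j = i ≢ j × (∃[ vs ] Path zero j vs × i ∈ vs)

Compatible : ∀ {n} → EdgeSet n → EdgeSet n → Set₁
Compatible {n} Y Y′ = Σ (Rel (V n) 0ℓ) λ _⊏_ →
  IsStrictTotalOrder _≡_ _⊏_ ×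
  (∀ {i j} → Precedes Y i j → i ⊏ j) ×
  (∀ {i j} → Precedes Y′ i j → i ⊏ j)

edges-complete : ∀ {n} (e : Edge n) → e ∈ edges n
edges-complete {n} (edge i j i<j) = ∈-concatMap⁺ (λ i → mapMaybe (edge? i) (allFin (suc n)))
  (lose (∈-allFin i) (mapMaybe⁺ (∈-allFin j)))
  where
  edge-just : edge? i j ≡ just (edge i j i<j)
  edge-just with i Fin.<? j
  ... | yes _  = refl
  ... | no i≮j = contradiction (recompute (i Fin.<? j) i<j) i≮j

  mapMaybe⁺ : ∀ {js} → j ∈ js → edge i j i<j ∈ mapMaybe (edge? i) js
  mapMaybe⁺ (here refl) rewrite edge-just = here refl
  mapMaybe⁺ {k ∷ _} (there j∈) with edge? i k
  ... | just _  = there (mapMaybe⁺ j∈)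
  ... | nothing = mapMaybe⁺ j∈

edges-unique : ∀ n → Unique (edges n)
edges-unique n = Unique.concat⁺
  (All.map⁺ (All.tabulate λ {i} _ → row i (Unique.allFin⁺ (suc n))))
  (AllPairs.map⁺ (AllPairs.map
    (λ {i} {j} i≢j {e} → λ (p , q) → i≢j (trans (sym (row-tail i (allFin _) p)) (row-tail j (allFin _) q)))
    (Unique.allFin⁺ (suc n))))
  where
  row-tail : ∀ i js {e} → e ∈ mapMaybe (edge? i) js → tail e ≡ i
  row-tail i (j ∷ js) e∈ with i Fin.<? j | e∈
  ... | yes _ | here refl = refl
  ... | yes _ | there e∈′ = row-tail i js e∈′
  ... | no _  | e∈′       = row-tail i js e∈′

  row-head : ∀ i js {e} → e ∈ mapMaybe (edge? i) js → head e ∈ js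
  row-head i (j ∷ js) e∈ with i Fin.<? j | e∈
  ... | yes _ | here refl = here refl
  ... | yes _ | there e∈′ = there (row-head i js e∈′)
  ... | no _  | e∈′       = there (row-head i js e∈′)

  row : ∀ i {js} → Unique js → Unique (mapMaybe (edge? i) js)
  row i []               = []
  row i {j ∷ js} (j∉ ∷ u) with i Fin.<? j
  ... | no _  = row i u
  ... | yes _ = All.tabulate (λ e∈ eq → All.lookup j∉ (row-head i js e∈) (cong head eq)) ∷ row i u

------------------------------------------------------------------------
-- Compatibility is decidable

joins? : ∀ {n} (e : Edge n) i j → Dec (Joins e i j)
joins? e i j = (tail e Fin.≟ i ×-dec head e Fin.≟ j) ⊎-dec (tail e Fin.≟ j ×-dec head e Fin.≟ i)

private

  anyList? : ∀ {m p} {P : List (Fin m) → Set p} → Unary.Decidable P →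
             ∀ k → Dec (∃[ vs ] length vs ℕ.≤ k × P vs)
  anyList? {P = P} P? zero = map′ (λ p → [] , z≤n , p) (λ { ([] , z≤n , p) → p }) (P? [])
  anyList? {P = P} P? (suc k) = map′ to from (P? [] ⊎-dec Fin.any? (λ x → anyList? (P? ∘ (x ∷_)) k))
    where
    to : P [] ⊎ (∃[ x ] ∃[ vs ] length vs ℕ.≤ k × P (x ∷ vs)) → ∃[ vs ] length vs ℕ.≤ suc k × P vs
    to (inj₁ p)                = [] , z≤n , p
    to (inj₂ (x , vs , l , p)) = x ∷ vs , s≤s l , p

    from : (∃[ vs ] length vs ℕ.≤ suc k × P vs) → P [] ⊎ (∃[ x ] ∃[ vs ] length vs ℕ.≤ k × P (x ∷ vs))
    from ([] , _ , p)           = inj₁ p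
    from (x ∷ vs , s≤s l , p)   = inj₂ (x , vs , l , p)

  lookup-injective : ∀ {a} {A : Set a} {xs : List A} → Unique xs →
                     ∀ {i j} → lookup xs i ≡ lookup xs j → i ≡ j
  lookup-injective (_ ∷ _)  {zero}  {zero}  _  = refl
  lookup-injective (p ∷ _)  {zero}  {suc j} eq = contradiction eq (All.lookup p (∈-lookup j))
  lookup-injective (p ∷ _)  {suc i} {zero}  eq = contradiction (sym eq) (All.lookup p (∈-lookup i))
  lookup-injective (_ ∷ u)  {suc i} {suc j} eq = cong suc (lookup-injective u eq)

module _ {n : ℕ} (Y : EdgeSet n) where

  private
    open DecMembership (Fin._≟_ {suc n}) using (_∈?_)

    path-unique : ∀ {i j vs} → Path Y i j vs → Unique vs
    path-unique stop           = [] ∷ []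
    path-unique (step _ i∉ p)  = All.¬Any⇒All¬ _ i∉ ∷ path-unique p

    path-length : ∀ {i j vs} → Path Y i j vs → length vs ℕ.≤ suc n
    path-length p = Fin.injective⇒≤ (lookup-injective (path-unique p))

    path-head : ∀ {i j v vs} → Path Y i j (v ∷ vs) → i ≡ v
    path-head stop         = refl
    path-head (step _ _ _) = refl

  adjacent? : Decidable (Adjacent Y)
  adjacent? i j with Fin.<-cmp i j
  ... | tri< i<j _ _ = map′ (λ y → edge i j i<j , y , inj₁ (refl , refl))
          (λ { (edge _ _ _ , y , inj₁ (refl , refl)) → y
             ; (edge _ _ j<i , y , inj₂ (refl , refl)) → contradiction (recompute (j Fin.<? i) j<i) (Fin.<-asym i<j) })
          (Y (edge i j i<j) Bool.≟ true)
  ... | tri≈ _ refl _ = no λ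
          { (edge _ _ p , _ , inj₁ (refl , refl)) → Fin.<-irrefl refl (recompute (i Fin.<? i) p)
          ; (edge _ _ p , _ , inj₂ (refl , refl)) → Fin.<-irrefl refl (recompute (i Fin.<? i) p) }
  ... | tri> _ _ j<i = map′ (λ y → edge j i j<i , y , inj₂ (refl , refl))
          (λ { (edge _ _ _ , y , inj₂ (refl , refl)) → y
             ; (edge _ _ i<j , y , inj₁ (refl , refl)) → contradiction (recompute (i Fin.<? j) i<j) (Fin.<-asym j<i) })
          (Y (edge j i j<i) Bool.≟ true)

  path? : ∀ i j vs → Dec (Path Y i j vs)
  path? i j []          = no λ ()
  path? i j (v ∷ [])    = map′ (λ { (refl , refl) → stop }) (λ { stop → refl , refl ; (step _ _ ()) })
                            (i Fin.≟ v ×-dec j Fin.≟ v)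
  path? i j (v ∷ w ∷ vs) = map′ (λ { (refl , a , v∉ , p) → step a v∉ p }) from
                            (i Fin.≟ v ×-dec adjacent? v w ×-dec ¬? (v ∈? (w ∷ vs)) ×-dec path? w j (w ∷ vs))
    where
    from : Path Y i j (v ∷ w ∷ vs) → i ≡ v × Adjacent Y v w × v ∉ (w ∷ vs) × Path Y w j (w ∷ vs)
    from (step a v∉ p) with refl ← path-head p = refl , a , v∉ , p

  precedes? : Decidable (Precedes Y)
  precedes? i j = ¬? (i Fin.≟ j) ×-dec
    map′ (λ (vs , _ , p) → vs , p) (λ (vs , p , i∈) → vs , path-length p , p , i∈)
      (anyList? (λ vs → path? zero j vs ×-dec i ∈? vs) (suc n))

private

  module _ {m : ℕ} where

    -- The relation whose graph is a given set of pairs.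
    rel : Vec Bool (m ℕ.* m) → Rel (Fin m) 0ℓ
    rel b i j = Vec.lookup b (combine i j) ≡ true

    rel? : ∀ b → Decidable (rel b)
    rel? b i j = Vec.lookup b (combine i j) Bool.≟ true

    module _ (_⊏_ : Rel (Fin m) 0ℓ) (_⊏?_ : Decidable _⊏_) where

      Axioms : Set
      Axioms = (∀ i → ¬ i ⊏ i) × (∀ i j k → i ⊏ j → j ⊏ k → i ⊏ k) × (∀ i j → i ⊏ j ⊎ i ≡ j ⊎ j ⊏ i)

      axioms? : Dec Axioms
      axioms? = Fin.all? (λ i → ¬? (i ⊏? i))
        ×-dec Fin.all? (λ i → Fin.all? λ j → Fin.all? λ k → i ⊏? j →-dec (j ⊏? k →-dec i ⊏? k))
        ×-dec Fin.all? (λ i → Fin.all? λ j → i ⊏? j ⊎-dec (i Fin.≟ j ⊎-dec j ⊏? i))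

      isStrictTotalOrder⁺ : Axioms → IsStrictTotalOrder _≡_ _⊏_
      isStrictTotalOrder⁺ (irr , tr , con) = record
        { isStrictPartialOrder = record
          { isEquivalence = isEquivalence
          ; irrefl        = λ { refl → irr _ }
          ; trans         = tr _ _ _
          ; <-resp-≈      = resp₂ _⊏_
          }
        ; compare = compare
        }
        where
        compare : ∀ i j → Tri (i ⊏ j) (i ≡ j) (j ⊏ i)
        compare i j with con i j
        ... | inj₁ lt          = tri< lt (λ { refl → irr _ lt }) (λ gt → irr _ (tr _ _ _ lt gt))
        ... | inj₂ (inj₁ refl) = tri≈ (irr _) refl (irr _)
        ... | inj₂ (inj₂ gt)   = tri> (λ lt → irr _ (tr _ _ _ lt gt)) (λ { refl → irr _ gt }) gt

      isStrictTotalOrder⁻ : IsStrictTotalOrder _≡_ _⊏_ → Axioms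
      isStrictTotalOrder⁻ o = (λ i → O.irrefl refl) , (λ i j k → O.trans) , con
        where
        module O = IsStrictTotalOrder o
        con : ∀ i j → i ⊏ j ⊎ i ≡ j ⊎ j ⊏ i
        con i j with O.compare i j
        ... | tri< lt _ _ = inj₁ lt
        ... | tri≈ _ eq _ = inj₂ (inj₁ eq)
        ... | tri> _ _ gt = inj₂ (inj₂ gt)

      isStrictTotalOrder? : Dec (IsStrictTotalOrder _≡_ _⊏_)
      isStrictTotalOrder? = map′ isStrictTotalOrder⁺ isStrictTotalOrder⁻ axioms?

    module _ (_⊏_ : Rel (Fin m) 0ℓ) (_⊏?_ : Decidable _⊏_) where

      private
        test : Fin (m ℕ.* m) → Bool
        test k = does (proj₁ (remQuot {m} m k) ⊏? proj₂ (remQuot {m} m k))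

      tabulation : Vec Bool (m ℕ.* m)
      tabulation = Vec.tabulate test

      private
        lookup-tabulation : ∀ i j → Vec.lookup tabulation (combine i j) ≡ does (i ⊏? j)
        lookup-tabulation i j = trans (Vec.lookup∘tabulate test (combine i j))
          (cong (λ (a , b) → does (a ⊏? b)) (Fin.remQuot-combine i j))

      rel⁺ : ∀ {i j} → i ⊏ j → rel tabulation i j
      rel⁺ {i} {j} lt with i ⊏? j | lookup-tabulation i j
      ... | yes _   | eq = eq
      ... | no ¬lt | _  = contradiction lt ¬lt

      rel⁻ : ∀ {i j} → rel tabulation i j → i ⊏ j
      rel⁻ {i} {j} r with i ⊏? j | lookup-tabulation i j
      ... | yes lt | _  = lt
      ... | no _   | eq = contradiction (trans (sym r) eq) λ ()

compatible? : ∀ {n} (Y Y′ : EdgeSet n) → Dec (Compatible Y Y′)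
compatible? {n} Y Y′ = map′ to from (anySubset? λ b →
    isStrictTotalOrder? (rel b) (rel? b) ×-dec
    Fin.all? (λ i → Fin.all? λ j → precedes? Y i j →-dec rel? b i j) ×-dec
    Fin.all? (λ i → Fin.all? λ j → precedes? Y′ i j →-dec rel? b i j))
  where
  Tabulated : Vec Bool (suc n ℕ.* suc n) → Set
  Tabulated b = IsStrictTotalOrder _≡_ (rel b) ×
    (∀ i j → Precedes Y i j → rel b i j) × (∀ i j → Precedes Y′ i j → rel b i j)

  to : ∃ Tabulated → Compatible Y Y′
  to (b , o , e , e′) = rel b , o , e _ _ , e′ _ _

  from : Compatible Y Y′ → ∃ Tabulated
  from (_⊏_ , o , e , e′) = tabulation _⊏_ O._<?_ ,
    isStrictTotalOrder⁺ _ (rel? (tabulation _⊏_ O._<?_))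
      ( (λ i → irr ∘ ⁻ {i} {i})
      , (λ i j k p q → ⁺ (tr (⁻ {i} {j} p) (⁻ {j} {k} q)))
      , con ) ,
    (λ i j → ⁺ ∘ e) , (λ i j → ⁺ ∘ e′)
    where
    module O = IsStrictTotalOrder o
    ⁺ : ∀ {i j} → i ⊏ j → rel (tabulation _⊏_ O._<?_) i j
    ⁺ = rel⁺ _⊏_ O._<?_
    ⁻ : ∀ {i j} → rel (tabulation _⊏_ O._<?_) i j → i ⊏ j
    ⁻ = rel⁻ _⊏_ O._<?_
    irr : ∀ {i} → ¬ i ⊏ i
    irr = O.irrefl refl
    tr : ∀ {i j k} → i ⊏ j → j ⊏ k → i ⊏ k
    tr = O.trans
    con : ∀ i j → rel (tabulation _⊏_ O._<?_) i j ⊎ i ≡ j ⊎ rel (tabulation _⊏_ O._<?_) j i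
    con i j with O.compare i j
    ... | tri< lt _ _ = inj₁ (⁺ lt)
    ... | tri≈ _ eq _ = inj₂ (inj₁ eq)
    ... | tri> _ _ gt = inj₂ (inj₂ (⁺ gt))

------------------------------------------------------------------------
-- Permutations

-- Sₙ, listed without repetition: permutations-complete and
-- permutations-distinct below.
permutations : ∀ n → List (Permutation′ n)
permutations zero    = Perm.id ∷ []
permutations (suc n) = cartesianProductWith (insert zero) (allFin (suc n)) (permutations n)

-- The extension of s by s(0) = 0.
extend : ∀ {n} → Permutation′ n → Permutation′ (suc n)
extend = lift₀

-- The edge {a,b} points a → b in Gˢ.
Arc : ∀ {n} → Permutation′ n → V n → V n → Set
Arc s a b = extend s ⟨$⟩ˡ a < extend s ⟨$⟩ˡ b

arc? : ∀ {n} (s : Permutation′ n) → Decidable (Arc s)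
arc? s a b = extend s ⟨$⟩ˡ a Fin.<? extend s ⟨$⟩ˡ b

-- The number of edges of Y pointing from head to tail in Gˢ.
mm : ∀ {n} → EdgeSet n → Permutation′ n → ℕ
mm Y s = length (filter (λ e → arc? s (head e) (tail e)) (elements Y))

-- T_s; here k : Fin n stands for the pair of positions k, k+1.
pathTree : ∀ {n} → Permutation′ n → EdgeSet n
pathTree s e = does (Fin.any? λ k →
  joins? e (extend s ⟨$⟩ʳ inject₁ k) (extend s ⟨$⟩ʳ suc k))

-- The pairs i < j with j ≠ i + 1.
nonConsecutive : ∀ n → List (Edge n)
nonConsecutive n = filter (λ e → ¬? (toℕ (head e) ℕ.≟ suc (toℕ (tail e)))) (edges n)

permutations-complete : ∀ {n} (s : Permutation′ n) → Any (s Perm.≈_) (permutations n)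
permutations-complete {zero}  s = here λ ()
permutations-complete {suc n} s =
  Any.cartesianProductWith⁺ (insert zero) combine≈ (∈-allFin (s ⟨$⟩ʳ zero))
    (permutations-complete (remove zero s))
  where
  combine≈ : ∀ {j π} → s ⟨$⟩ʳ zero ≡ j → remove zero s Perm.≈ π → s Perm.≈ insert zero j π
  combine≈ {π = π} refl r zero    = refl
  combine≈ {π = π} refl r (suc i) = trans (sym (insert-remove zero s (suc i)))
    (trans (insert-punchIn zero (s ⟨$⟩ʳ zero) (remove zero s) i)
      (trans (cong (punchIn (s ⟨$⟩ʳ zero)) (r i))
        (sym (insert-punchIn zero (s ⟨$⟩ʳ zero) π i))))

permutations-distinct : ∀ n → AllPairs (λ s s′ → ¬ s Perm.≈ s′) (permutations n)
permutations-distinct zero    = [] ∷ []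
permutations-distinct (suc n) = product⁺ (Unique.allFin⁺ (suc n))
  where
  inj₁′ : ∀ {j j′ π π′} → insert zero j π Perm.≈ insert zero j′ π′ → j ≡ j′
  inj₁′ eq = eq zero

  inj₂′ : ∀ {j π π′} → insert zero j π Perm.≈ insert zero j π′ → π Perm.≈ π′
  inj₂′ {j} {π} {π′} eq i = Fin.punchIn-injective j _ _
    (trans (sym (insert-punchIn zero j π i)) (trans (eq (suc i)) (insert-punchIn zero j π′ i)))

  product⁺ : ∀ {js} → Unique js →
    AllPairs (λ s s′ → ¬ s Perm.≈ s′) (cartesianProductWith (insert zero) js (permutations n))
  product⁺ []               = []
  product⁺ {j ∷ js} (j∉ ∷ u) = AllPairs.++⁺
    (AllPairs.map⁺ (AllPairs.map (λ {π} {π′} ¬eq eq → ¬eq (inj₂′ {j} {π} {π′} eq)) (permutations-distinct n)))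
    (product⁺ u)
    (All.map⁺ (All.tabulate λ {π} _ → All.cartesianProductWith⁺ (≡.setoid _) (≡.setoid _) (insert zero) js (permutations n)
      λ {j′} {π′} j′∈ _ eq → All.lookup j∉ j′∈ (inj₁′ {j} {j′} {π} {π′} eq)))

------------------------------------------------------------------------
-- The polynomial ring K[t(1),…,t(n)]

Monomial : ℕ → Set
Monomial = Vec ℕ

module Polynomial {c ℓ} (K : CommutativeRing c ℓ) (n : ℕ) where

  private module K = CommutativeRing K

  -- A polynomial is a formal sum of terms, in which a monomial (a vector of
  -- exponents) may occur repeatedly; polynomials with the same coefficients
  -- are equal.
  Poly : Set c
  Poly = List (K.Carrier × Monomial n)

  coeff : Poly → Monomial n → K.Carrier
  coeff []            m = K.0#
  coeff ((x , a) ∷ p) m = (if does (Vec.≡-dec ℕ._≟_ a m) then x else K.0#) K.+ coeff p m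

  infix 4 _≈ₚ_
  _≈ₚ_ : Rel Poly ℓ
  p ≈ₚ q = ∀ m → coeff p m K.≈ coeff q m

  infixl 6 _⊕_
  _⊕_ : Monomial n → Monomial n → Monomial n
  _⊕_ = Vec.zipWith ℕ._+_

  𝟎 : Monomial n
  𝟎 = Vec.replicate n 0

  _+ₚ_ _*ₚ_ : Poly → Poly → Poly
  _+ₚ_ = _++_
  _*ₚ_ = cartesianProductWith λ (x , a) (y , b) → x K.* y , a ⊕ b

  -ₚ_ : Poly → Poly
  -ₚ_ = map λ (x , a) → K.- x , a

  0ₚ 1ₚ : Poly
  0ₚ = []
  1ₚ = (K.1# , 𝟎) ∷ []

  var : Fin n → Poly
  var i = (K.1# , 𝟎 Vec.[ i ]≔ 1) ∷ []

  private module Laws where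

    open CommutativeRing K hiding (zero)
      renaming (refl to ≈-refl; sym to ≈-sym; trans to ≈-trans)
    open RingProperties ring using (-‿distribˡ-*; -‿+-comm; -0#≈0#)
    open CommutativeSemigroupProperties +-commutativeSemigroup using (interchange)
    open SetoidReasoning setoid
    module C* = CommutativeSemigroupProperties *-commutativeSemigroup

    -- The linear functional sending each monomial a to f a.
    ∫ : Poly → (Monomial n → Carrier) → Carrier
    ∫ []            f = 0#
    ∫ ((x , a) ∷ p) f = x * f a + ∫ p f

    δ : Monomial n → Monomial n → Carrier
    δ m a = if does (Vec.≡-dec ℕ._≟_ a m) then 1# else 0#

    coeff≈∫ : ∀ p m → coeff p m ≈ ∫ p (δ m)
    coeff≈∫ []            m = ≈-refl
    coeff≈∫ ((x , a) ∷ p) m = +-cong term (coeff≈∫ p m)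
      where
      term : (if does (Vec.≡-dec ℕ._≟_ a m) then x else 0#) ≈ x * δ m a
      term with does (Vec.≡-dec ℕ._≟_ a m)
      ... | true  = ≈-sym (*-identityʳ x)
      ... | false = ≈-sym (zeroʳ x)

    ∫-cong : ∀ p {f g} → (∀ a → f a ≈ g a) → ∫ p f ≈ ∫ p g
    ∫-cong []            eq = ≈-refl
    ∫-cong ((x , a) ∷ p) eq = +-cong (*-congˡ (eq a)) (∫-cong p eq)

    ∫-+ : ∀ p q f → ∫ (p ++ q) f ≈ ∫ p f + ∫ q f
    ∫-+ []            q f = ≈-sym (+-identityˡ _)
    ∫-+ ((x , a) ∷ p) q f = ≈-trans (+-congˡ (∫-+ p q f)) (≈-sym (+-assoc _ _ _))

    ∫-neg : ∀ p f → ∫ (-ₚ p) f ≈ - ∫ p f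
    ∫-neg []            f = ≈-sym -0#≈0#
    ∫-neg ((x , a) ∷ p) f = ≈-trans (+-cong (≈-sym (-‿distribˡ-* x (f a))) (∫-neg p f)) (-‿+-comm _ _)

    ∫-zero : ∀ p → ∫ p (λ _ → 0#) ≈ 0#
    ∫-zero []            = ≈-refl
    ∫-zero ((x , a) ∷ p) = ≈-trans (+-cong (zeroʳ x) (∫-zero p)) (+-identityˡ 0#)

    ∫-scale : ∀ p k f → ∫ p (λ a → k * f a) ≈ k * ∫ p f
    ∫-scale []            k f = ≈-sym (zeroʳ k)
    ∫-scale ((x , a) ∷ p) k f = ≈-trans (+-cong (C*.x∙yz≈y∙xz x k (f a)) (∫-scale p k f)) (≈-sym (distribˡ k _ _))

    ∫-add : ∀ p f g → ∫ p (λ a → f a + g a) ≈ ∫ p f + ∫ p g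
    ∫-add []            f g = ≈-sym (+-identityˡ 0#)
    ∫-add ((x , a) ∷ p) f g = ≈-trans (+-cong (distribˡ x _ _) (∫-add p f g)) (interchange _ _ _ _)

    ∫-swap : ∀ p q (g : Monomial n → Monomial n → Carrier) →
             ∫ p (λ a → ∫ q (g a)) ≈ ∫ q (λ b → ∫ p (λ a → g a b))
    ∫-swap []            q g = ≈-sym (∫-zero q)
    ∫-swap ((x , a) ∷ p) q g = begin
      x * ∫ q (g a) + ∫ p (λ a → ∫ q (g a))                  ≈⟨ +-cong (≈-sym (∫-scale q x (g a))) (∫-swap p q g) ⟩
      ∫ q (λ b → x * g a b) + ∫ q (λ b → ∫ p (λ a → g a b))  ≈⟨ ∫-add q _ _ ⟨
      ∫ q (λ b → x * g a b + ∫ p (λ a → g a b))              ∎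

    ∫-* : ∀ p q f → ∫ (p *ₚ q) f ≈ ∫ p (λ a → ∫ q (λ b → f (a ⊕ b)))
    ∫-* []            q f = ≈-refl
    ∫-* ((x , a) ∷ p) q f = ≈-trans (∫-+ (map _ q) (p *ₚ q) f) (+-cong (row q) (∫-* p q f))
      where
      row : ∀ q → ∫ (map (λ (y , b) → x * y , a ⊕ b) q) f ≈ x * ∫ q (λ b → f (a ⊕ b))
      row []            = ≈-sym (zeroʳ x)
      row ((y , b) ∷ q) = ≈-trans (+-cong (*-assoc x y _) (row q)) (≈-sym (distribˡ x _ _))

    -- Equality under all such functionals implies equality of coefficients.
    ext : ∀ {p q} → (∀ f → ∫ p f ≈ ∫ q f) → p ≈ₚ q
    ext {p} {q} eq m = ≈-trans (coeff≈∫ p m) (≈-trans (eq (δ m)) (≈-sym (coeff≈∫ q m)))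

    ⊕-comm : ∀ a b → a ⊕ b ≡ b ⊕ a
    ⊕-comm = Vec.zipWith-comm ℕ.+-comm

    ⊕-assoc : ∀ a b d → (a ⊕ b) ⊕ d ≡ a ⊕ (b ⊕ d)
    ⊕-assoc = Vec.zipWith-assoc ℕ.+-assoc

    ⊕-identityˡ : ∀ a → 𝟎 ⊕ a ≡ a
    ⊕-identityˡ = Vec.zipWith-identityˡ ℕ.+-identityˡ

    *-commₚ : ∀ p q → (p *ₚ q) ≈ₚ (q *ₚ p)
    *-commₚ p q = ext {p *ₚ q} {q *ₚ p} λ f → begin
      ∫ (p *ₚ q) f                        ≈⟨ ∫-* p q f ⟩
      ∫ p (λ a → ∫ q (λ b → f (a ⊕ b)))   ≈⟨ ∫-swap p q _ ⟩
      ∫ q (λ b → ∫ p (λ a → f (a ⊕ b)))   ≈⟨ ∫-cong q (λ b → ∫-cong p λ a → reflexive (cong f (⊕-comm a b))) ⟩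
      ∫ q (λ b → ∫ p (λ a → f (b ⊕ a)))   ≈⟨ ∫-* q p f ⟨
      ∫ (q *ₚ p) f                        ∎

    *-assocₚ : ∀ p q r → ((p *ₚ q) *ₚ r) ≈ₚ (p *ₚ (q *ₚ r))
    *-assocₚ p q r = ext {(p *ₚ q) *ₚ r} {p *ₚ (q *ₚ r)} λ f → begin
      ∫ ((p *ₚ q) *ₚ r) f                                     ≈⟨ ∫-* (p *ₚ q) r f ⟩
      ∫ (p *ₚ q) (λ a → ∫ r (λ d → f (a ⊕ d)))                ≈⟨ ∫-* p q _ ⟩
      ∫ p (λ a → ∫ q (λ b → ∫ r (λ d → f ((a ⊕ b) ⊕ d))))     ≈⟨ ∫-cong p (λ a → ∫-cong q λ b → ∫-cong r λ d → reflexive (cong f (⊕-assoc a b d))) ⟩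
      ∫ p (λ a → ∫ q (λ b → ∫ r (λ d → f (a ⊕ (b ⊕ d)))))     ≈⟨ ∫-cong p (λ a → ∫-* q r (λ e → f (a ⊕ e))) ⟨
      ∫ p (λ a → ∫ (q *ₚ r) (λ e → f (a ⊕ e)))                ≈⟨ ∫-* p (q *ₚ r) f ⟨
      ∫ (p *ₚ (q *ₚ r)) f                                     ∎

    *-identityˡₚ : ∀ p → (1ₚ *ₚ p) ≈ₚ p
    *-identityˡₚ p = ext {1ₚ *ₚ p} {p} λ f → begin
      ∫ (1ₚ *ₚ p) f                      ≈⟨ ∫-* 1ₚ p f ⟩
      1# * ∫ p (λ b → f (𝟎 ⊕ b)) + 0#    ≈⟨ ≈-trans (+-identityʳ _) (*-identityˡ _) ⟩
      ∫ p (λ b → f (𝟎 ⊕ b))              ≈⟨ ∫-cong p (λ b → reflexive (cong f (⊕-identityˡ b))) ⟩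
      ∫ p f                              ∎

    distribʳₚ : ∀ p q r → ((q +ₚ r) *ₚ p) ≈ₚ ((q *ₚ p) +ₚ (r *ₚ p))
    distribʳₚ p q r = ext {(q +ₚ r) *ₚ p} {(q *ₚ p) +ₚ (r *ₚ p)} λ f → begin
      ∫ ((q +ₚ r) *ₚ p) f                  ≈⟨ ∫-* (q +ₚ r) p f ⟩
      ∫ (q +ₚ r) _                         ≈⟨ ∫-+ q r _ ⟩
      ∫ q _ + ∫ r _                        ≈⟨ +-cong (∫-* q p f) (∫-* r p f) ⟨
      ∫ (q *ₚ p) f + ∫ (r *ₚ p) f          ≈⟨ ∫-+ (q *ₚ p) (r *ₚ p) f ⟨
      ∫ ((q *ₚ p) +ₚ (r *ₚ p)) f           ∎

    divides? : ∀ {k} (a m : Vec ℕ k) → Dec (∃[ d ] Vec.zipWith ℕ._+_ a d ≡ m)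
    divides? []      []      = yes ([] , refl)
    divides? (x ∷ a) (y ∷ m) with x ℕ.≤? y | divides? a m
    ... | yes x≤y | yes (d , eq) = yes ((y ℕ.∸ x) ∷ d , cong₂ _∷_ (ℕ.m+[n∸m]≡n x≤y) eq)
    ... | no x≰y  | _            = no λ { (z ∷ d , eq) → x≰y (ℕ.m+n≤o⇒m≤o x (ℕ.≤-reflexive (Vec.∷-injectiveˡ eq))) }
    ... | _       | no ∤         = no λ { (z ∷ d , eq) → ∤ (d , Vec.∷-injectiveʳ eq) }

    ⊕-cancelˡ : ∀ {k} (a b d : Vec ℕ k) → Vec.zipWith ℕ._+_ a b ≡ Vec.zipWith ℕ._+_ a d → b ≡ d
    ⊕-cancelˡ []      []      []      _  = refl
    ⊕-cancelˡ (x ∷ a) (y ∷ b) (z ∷ d) eq =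
      cong₂ _∷_ (ℕ.+-cancelˡ-≡ x y z (Vec.∷-injectiveˡ eq)) (⊕-cancelˡ a b d (Vec.∷-injectiveʳ eq))

    δ-shift : ∀ {a d m} → a ⊕ d ≡ m → ∀ b → δ m (a ⊕ b) ≈ δ d b
    δ-shift {a} {d} {m} eq b with Vec.≡-dec ℕ._≟_ (a ⊕ b) m | Vec.≡-dec ℕ._≟_ b d
    ... | yes _ | yes _ = ≈-refl
    ... | no _  | no _  = ≈-refl
    ... | yes p | no ¬q = contradiction (⊕-cancelˡ a b d (trans p (sym eq))) ¬q
    ... | no ¬p | yes q = contradiction (trans (cong (a ⊕_) q) eq) ¬p

    δ-zero : ∀ {a m} → ¬ (∃[ d ] a ⊕ d ≡ m) → ∀ b → δ m (a ⊕ b) ≈ 0#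
    δ-zero {a} {m} ∤ b with Vec.≡-dec ℕ._≟_ (a ⊕ b) m
    ... | yes p = contradiction (b , p) ∤
    ... | no _  = ≈-refl

    *-congˡₚ : ∀ p {q r} → q ≈ₚ r → (p *ₚ q) ≈ₚ (p *ₚ r)
    *-congˡₚ p {q} {r} eq m = begin
      coeff (p *ₚ q) m                         ≈⟨ coeff≈∫ (p *ₚ q) m ⟩
      ∫ (p *ₚ q) (δ m)                         ≈⟨ ∫-* p q (δ m) ⟩
      ∫ p (λ a → ∫ q (λ b → δ m (a ⊕ b)))      ≈⟨ ∫-cong p shifted ⟩
      ∫ p (λ a → ∫ r (λ b → δ m (a ⊕ b)))      ≈⟨ ∫-* p r (δ m) ⟨
      ∫ (p *ₚ r) (δ m)                         ≈⟨ coeff≈∫ (p *ₚ r) m ⟨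
      coeff (p *ₚ r) m                         ∎
      where
      shifted : ∀ a → ∫ q (λ b → δ m (a ⊕ b)) ≈ ∫ r (λ b → δ m (a ⊕ b))
      shifted a with divides? a m
      ... | yes (d , a⊕d≡m) = begin
        ∫ q (λ b → δ m (a ⊕ b))   ≈⟨ ∫-cong q (δ-shift a⊕d≡m) ⟩
        ∫ q (δ d)                 ≈⟨ coeff≈∫ q d ⟨
        coeff q d                 ≈⟨ eq d ⟩
        coeff r d                 ≈⟨ coeff≈∫ r d ⟩
        ∫ r (δ d)                 ≈⟨ ∫-cong r (δ-shift a⊕d≡m) ⟨
        ∫ r (λ b → δ m (a ⊕ b))   ∎
      ... | no ∤ = begin
        ∫ q (λ b → δ m (a ⊕ b))   ≈⟨ ∫-cong q (δ-zero ∤) ⟩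
        ∫ q (λ _ → 0#)            ≈⟨ ≈-trans (∫-zero q) (≈-sym (∫-zero r)) ⟩
        ∫ r (λ _ → 0#)            ≈⟨ ∫-cong r (δ-zero ∤) ⟨
        ∫ r (λ b → δ m (a ⊕ b))   ∎

    coeff-+ : ∀ p q m → coeff (p +ₚ q) m ≈ coeff p m + coeff q m
    coeff-+ []            q m = ≈-sym (+-identityˡ _)
    coeff-+ ((x , a) ∷ p) q m = ≈-trans (+-congˡ (coeff-+ p q m)) (≈-sym (+-assoc _ _ _))

    coeff-neg : ∀ p m → coeff (-ₚ p) m ≈ - coeff p m
    coeff-neg p m = begin
      coeff (-ₚ p) m   ≈⟨ coeff≈∫ (-ₚ p) m ⟩
      ∫ (-ₚ p) (δ m)   ≈⟨ ∫-neg p (δ m) ⟩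
      - ∫ p (δ m)      ≈⟨ -‿cong (coeff≈∫ p m) ⟨
      - coeff p m      ∎

    ≈ₚ-trans : ∀ {p q r} → p ≈ₚ q → q ≈ₚ r → p ≈ₚ r
    ≈ₚ-trans e e′ m = ≈-trans (e m) (e′ m)

    +-commₚ : ∀ p q → (p +ₚ q) ≈ₚ (q +ₚ p)
    +-commₚ p q m = ≈-trans (coeff-+ p q m) (≈-trans (+-comm _ _) (≈-sym (coeff-+ q p m)))

    +-congₚ : ∀ {p q r s} → p ≈ₚ q → r ≈ₚ s → (p +ₚ r) ≈ₚ (q +ₚ s)
    +-congₚ {p} {q} {r} {s} e e′ m =
      ≈-trans (coeff-+ p r m) (≈-trans (+-cong (e m) (e′ m)) (≈-sym (coeff-+ q s m)))

    inverseʳₚ : ∀ p → (p +ₚ (-ₚ p)) ≈ₚ 0ₚ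
    inverseʳₚ p m = ≈-trans (coeff-+ p (-ₚ p) m) (≈-trans (+-congˡ (coeff-neg p m)) (-‿inverseʳ _))

    inverseˡₚ : ∀ p → ((-ₚ p) +ₚ p) ≈ₚ 0ₚ
    inverseˡₚ p = ≈ₚ-trans {(-ₚ p) +ₚ p} {p +ₚ (-ₚ p)} {0ₚ} (+-commₚ (-ₚ p) p) (inverseʳₚ p)

    +-assocₚ : ∀ p q r → ((p +ₚ q) +ₚ r) ≈ₚ (p +ₚ (q +ₚ r))
    +-assocₚ p q r m = reflexive (cong (λ s → coeff s m) (++-assoc p q r))

    +-identityʳₚ : ∀ p → (p +ₚ 0ₚ) ≈ₚ p
    +-identityʳₚ p m = reflexive (cong (λ s → coeff s m) (++-identityʳ p))

    *-congₚ : ∀ {p q r s} → p ≈ₚ q → r ≈ₚ s → (p *ₚ r) ≈ₚ (q *ₚ s)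
    *-congₚ {p} {q} {r} {s} e e′ m = begin
      coeff (p *ₚ r) m   ≈⟨ *-congˡₚ p {r} {s} e′ m ⟩
      coeff (p *ₚ s) m   ≈⟨ *-commₚ p s m ⟩
      coeff (s *ₚ p) m   ≈⟨ *-congˡₚ s {p} {q} e m ⟩
      coeff (s *ₚ q) m   ≈⟨ *-commₚ s q m ⟩
      coeff (q *ₚ s) m   ∎

    *-identityʳₚ : ∀ p → (p *ₚ 1ₚ) ≈ₚ p
    *-identityʳₚ p = ≈ₚ-trans {p *ₚ 1ₚ} {1ₚ *ₚ p} {p} (*-commₚ p 1ₚ) (*-identityˡₚ p)

    distribˡₚ : ∀ p q r → (p *ₚ (q +ₚ r)) ≈ₚ ((p *ₚ q) +ₚ (p *ₚ r))
    distribˡₚ p q r m = begin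
      coeff (p *ₚ (q +ₚ r)) m          ≈⟨ *-commₚ p (q +ₚ r) m ⟩
      coeff ((q +ₚ r) *ₚ p) m          ≈⟨ distribʳₚ p q r m ⟩
      coeff ((q *ₚ p) +ₚ (r *ₚ p)) m   ≈⟨ +-congₚ {q *ₚ p} {p *ₚ q} {r *ₚ p} {p *ₚ r} (*-commₚ q p) (*-commₚ r p) m ⟩
      coeff ((p *ₚ q) +ₚ (p *ₚ r)) m   ∎

    isCommutativeRingₚ : IsCommutativeRing _≈ₚ_ _+ₚ_ _*ₚ_ -ₚ_ 0ₚ 1ₚ
    isCommutativeRingₚ = record
      { isRing = record
        { +-isAbelianGroup = record
          { isGroup = record
            { isMonoid = record
              { isSemigroup = record
                { isMagma = record
                  { isEquivalence = record
                    { refl  = λ _ → ≈-refl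
                    ; sym   = λ e m → ≈-sym (e m)
                    ; trans = λ {p} {q} {r} → ≈ₚ-trans {p} {q} {r}
                    }
                  ; ∙-cong = λ {p} {q} {r} {s} → +-congₚ {p} {q} {r} {s}
                  }
                ; assoc = +-assocₚ
                }
              ; identity = (λ _ _ → ≈-refl) , +-identityʳₚ
              }
            ; inverse = inverseˡₚ , inverseʳₚ
            ; ⁻¹-cong = λ {p} {q} e m →
                ≈-trans (coeff-neg p m) (≈-trans (-‿cong (e m)) (≈-sym (coeff-neg q m)))
            }
          ; comm = +-commₚ
          }
        ; *-cong     = λ {p} {q} {r} {s} → *-congₚ {p} {q} {r} {s}
        ; *-assoc    = *-assocₚ
        ; *-identity = *-identityˡₚ , *-identityʳₚ
        ; distrib    = distribˡₚ , distribʳₚ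
        }
      ; *-comm = *-commₚ
      }

  K[t] : CommutativeRing c ℓ
  K[t] = record { isCommutativeRing = Laws.isCommutativeRingₚ }

  open CommutativeRing K[t] public using (_≈_; _+_; _*_; _-_; -_; 0#; 1#)
  open Exp (CommutativeRing.semiring K[t]) public using (_^_)

  ∑ ∏ : ∀ {a} {A : Set a} → List A → (A → Poly) → Poly
  ∑ xs f = foldr _+_ 0# (map f xs)
  ∏ xs f = foldr _*_ 1# (map f xs)

  t : V n → Poly
  t zero    = 0#
  t (suc i) = var i

  p : EdgeSet n → Poly
  p Y = ∏ (elements Y) λ x → t (head x) - t (tail x)

  𝐏 : Permutation′ n → Poly
  𝐏 s = ∏ (nonConsecutive n) λ x → t (extend s ⟨$⟩ʳ head x) - t (extend s ⟨$⟩ʳ tail x)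

  C : EdgeSet n → EdgeSet n → Poly
  C Y Y′ = if does (compatible? Y Y′) then 1# else 0#

{-# OPTIONS --safe #-}
module Submission where

-- Since T_s is the path s(0), …, s(n), a tree T is compatible with T_s exactly
-- when s is a linear extension of ≺_T.  Dividing by p_G, the theorem says that
-- ∏ 1/(t(v) - t(u)) over the edges u → v of T rooted at 0 is the sum of
-- ∏ 1/(t(s(k)) - t(s(k-1))) over the linear extensions s.  This follows by
-- adding one leaf v with parent u at a time: a linear extension of the larger tree
-- inserts v somewhere after u into one of the smaller tree, and the sum over
-- these insertions telescopes, because inserting v between neighbours a and b
-- multiplies the product by 1/(t(v) - t(a)) - 1/(t(v) - t(b)).  All identities
-- are used in the form multiplied out by p_G, valid in any commutative ring.

open import Defs
open import Algebra.Bundles using (CommutativeMonoid; CommutativeRing)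
import Algebra.Properties.CommutativeSemigroup as CommutativeSemigroupProperties
import Algebra.Properties.Ring as RingProperties
import Algebra.Properties.Semiring.Exp as Exp
import Algebra.Solver.Ring.NaturalCoefficients.Default as SemiringSolver
open import Data.Bool.Base using (Bool; true; false; if_then_else_)
import Data.Bool.Properties as Bool
open import Data.Empty using (⊥; ⊥-elim)
open import Data.Fin.Base using (Fin; zero; suc; toℕ; inject₁; _<_; _≤_)
open import Data.Fin.Induction using (<-weakInduction)
open import Data.Fin.Permutation using (Permutation; Permutation′; permutation; remove; lift₀-remove; lift₀-cong; ↔⇒≡; _⟨$⟩ʳ_; _⟨$⟩ˡ_; inverseˡ; inverseʳ)
import Data.Fin.Permutation as Perm
import Data.Fin.Properties as Fin
open import Data.List.Base using (List; []; _∷_; _++_; _∷ʳ_; foldr; length; lookup; map; concatMap; mapMaybe; filter; drop; tabulate; allFin)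
open import Data.List.Membership.Propositional using (_∈_; _∉_; find; lose)
open import Data.List.Membership.Propositional.Properties
  using (∈-++⁻; ∈-++⁺ˡ; ∈-++⁺ʳ; ∈-∃++; ∈-map⁺; ∈-map⁻; ∈-concatMap⁺; ∈-concatMap⁻; ∈-filter⁺; ∈-filter⁻; ∈-lookup; ∈-tabulate⁺; ∈-allFin)
open import Data.List.Membership.Propositional.Properties.WithK using (unique∧set⇒bag)
import Data.List.Membership.DecPropositional as DecMembership
open import Data.List.Properties using (∷-injectiveˡ; ∷-injectiveʳ; tabulate-cong; tabulate-lookup)
open import Data.List.Relation.Binary.BagAndSetEquality using (∼bag⇒↭)
open import Data.List.Relation.Binary.Disjoint.Propositional using (Disjoint)
open import Data.List.Relation.Binary.Permutation.Propositional using (_↭_; ↭-refl; ↭-sym; ↭-trans; ↭⇒↭ₛ; prep)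
import Data.List.Relation.Binary.Permutation.Propositional as ↭
open import Data.List.Relation.Binary.Permutation.Propositional.Properties using (shift; drop-mid; ∈-resp-↭; ↭-singleton-inv)
open import Data.List.Relation.Binary.Permutation.Setoid.Properties using (Unique-resp-↭)
open import Data.List.Relation.Binary.Pointwise using (≡⇒Pointwise-≡)
import Data.List.Relation.Binary.Pointwise as Pointwise
open import Data.List.Relation.Unary.All using (All; []; _∷_)
import Data.List.Relation.Unary.All as All
import Data.List.Relation.Unary.All.Properties as All
open import Data.List.Relation.Unary.AllPairs using (AllPairs; []; _∷_)
import Data.List.Relation.Unary.AllPairs as AllPairs
import Data.List.Relation.Unary.AllPairs.Properties as AllPairs
open import Data.List.Relation.Unary.Any using (here; there; index)
open import Data.List.Relation.Unary.Any.Properties using (lookup-index)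
open import Data.List.Relation.Unary.Unique.Propositional using (Unique)
import Data.List.Relation.Unary.Unique.Propositional.Properties as Unique
open import Data.Nat.Base as ℕ using (ℕ; zero; suc; z≤n; s≤s)
import Data.Nat.Properties as ℕ
open import Data.Product.Base using (∃-syntax; ∃₂; _×_; _,_; proj₁)
open import Data.Sum.Base using (_⊎_; inj₁; inj₂; swap)
open import Function.Base using (_∘_; id)
open import Function.Bundles using (mk⇔)
open import Level using (0ℓ)
open import Relation.Binary.Core using (Rel)
open import Relation.Binary.Definitions using (DecidableEquality; Tri; tri<; tri≈; tri>; Transitive)
open import Relation.Binary.PropositionalEquality using (_≡_; _≢_; refl; sym; trans; cong; subst; subst₂; isEquivalence; resp₂)
import Relation.Binary.PropositionalEquality as ≡
import Relation.Binary.Reasoning.Setoid as SetoidReasoning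
open import Relation.Binary.Structures using (IsStrictTotalOrder)
open import Relation.Nullary.Decidable using (Dec; yes; no; does; ¬?; dec-true; dec-false; decidable-stable; recompute)
open import Relation.Nullary.Negation using (¬_; contradiction)
open import Relation.Unary using (Decidable)

-- Insertions into lists

module _ {a} {A : Set a} where

  -- v is never inserted at the front.
  insertions : A → List A → List (List A)
  insertions v []      = []
  insertions v (x ∷ w) = (x ∷ v ∷ w) ∷ map (x ∷_) (insertions v w)

  InsertedAfter : A → A → Rel (List A) a
  InsertedAfter u v w w′ = ∃₂ λ xs ys → u ∈ xs × w ≡ xs ++ ys × w′ ≡ xs ++ v ∷ ys

  insertedAfter-∷ : ∀ {u v w w′} x → InsertedAfter u v w w′ → InsertedAfter u v (x ∷ w) (x ∷ w′)
  insertedAfter-∷ x (xs , ys , u∈ , refl , refl) = x ∷ xs , ys , there u∈ , refl , refl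

  insertedAfter-↭ : ∀ {u v w w′} → InsertedAfter u v w w′ → w′ ↭ v ∷ w
  insertedAfter-↭ {v = v} (xs , ys , _ , refl , refl) = shift v xs ys

  -- The prefix contains `u`, so it is nonempty and the first entry of `w` is also the first entry
  -- of `w′`.
  insertedAfter-drop-↭ : ∀ {u v w w′} → InsertedAfter u v w w′ → drop 1 w′ ↭ v ∷ drop 1 w
  insertedAfter-drop-↭ {v = v} (x ∷ xs , ys , _ , refl , refl) = shift v xs ys

  ∈-insertions⁻ : ∀ {v w w′} x → w′ ∈ insertions v (x ∷ w) → InsertedAfter x v (x ∷ w) w′
  ∈-insertions⁻ x (here refl) = x ∷ [] , _ , here refl , refl , refl
  ∈-insertions⁻ {w = y ∷ w} x (there w′∈) with ∈-map⁻ (x ∷_) w′∈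
  ... | w″ , w″∈ , refl with ∈-insertions⁻ y w″∈
  ...   | xs , ys , _ , eq , refl = x ∷ xs , ys , here refl , cong (x ∷_) eq , refl

  ∈-insertions⁺ : ∀ {v x} xs {ys} → x ∷ xs ++ v ∷ ys ∈ insertions v (x ∷ xs ++ ys)
  ∈-insertions⁺ []       = here refl
  ∈-insertions⁺ (y ∷ xs) = there (∈-map⁺ (_ ∷_) (∈-insertions⁺ xs))

  -- The list with `v` directly behind the head `x` differs from all the others in its second entry:
  -- there they have the first entry of `w`, which is not `v`.
  insertions-unique : ∀ {v w} → v ∉ w → Unique (insertions v w)
  insertions-unique {w = []}    _  = []
  insertions-unique {v} {x ∷ w} v∉ = All.map⁺ (All.tabulate (fresh w (v∉ ∘ there)))
    ∷ Unique.map⁺ ∷-injectiveʳ (insertions-unique (v∉ ∘ there))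
    where
    fresh : ∀ w → v ∉ w → ∀ {w′} → w′ ∈ insertions v w → x ∷ v ∷ w ≢ x ∷ w′
    fresh (y ∷ w) v∉ (here refl) eq = v∉ (here (∷-injectiveˡ (∷-injectiveʳ eq)))
    fresh (y ∷ w) v∉ (there w′∈) eq with ∈-map⁻ (y ∷_) w′∈
    ... | _ , _ , refl = v∉ (here (∷-injectiveˡ (∷-injectiveʳ eq)))

  -- As `v` occurs only once in `w′`, its place there is determined, and deleting it recovers the
  -- shorter list.
  insertedAfter-injective : ∀ {u v w₁ w₂ w′} → v ∉ w₁ → v ∉ w₂ →
    InsertedAfter u v w₁ w′ → InsertedAfter u v w₂ w′ → w₁ ≡ w₂
  insertedAfter-injective v∉₁ v∉₂ (xs₁ , ys₁ , _ , refl , refl) (xs₂ , ys₂ , _ , refl , eq) =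
    delete xs₁ xs₂ v∉₁ v∉₂ eq
    where
    delete : ∀ {v} xs₁ xs₂ {ys₁ ys₂} → v ∉ xs₁ ++ ys₁ → v ∉ xs₂ ++ ys₂ →
             xs₁ ++ v ∷ ys₁ ≡ xs₂ ++ v ∷ ys₂ → xs₁ ++ ys₁ ≡ xs₂ ++ ys₂
    delete []        []        _   _   eq = ∷-injectiveʳ eq
    delete []        (_ ∷ _)   _   v∉₂ eq = contradiction (here (∷-injectiveˡ eq)) v∉₂
    delete (_ ∷ _)   []        v∉₁ _   eq = contradiction (here (sym (∷-injectiveˡ eq))) v∉₁
    delete (x ∷ xs₁) (_ ∷ xs₂) v∉₁ v∉₂ eq with refl ← ∷-injectiveˡ eq =
      cong (x ∷_) (delete xs₁ xs₂ (v∉₁ ∘ there) (v∉₂ ∘ there) (∷-injectiveʳ eq))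

  allPairs-delete : ∀ {r} {R : Rel A r} xs {v ys} → AllPairs R (xs ++ v ∷ ys) →
                    AllPairs R (xs ++ ys) × All (λ x → R x v) xs × All (R v) ys
  allPairs-delete []       (v~ ∷ p) = p , [] , v~
  allPairs-delete (x ∷ xs) (x~ ∷ p) with allPairs-delete xs p | All.++⁻ xs x~
  ... | p′ , xs~ , ~ys | x~xs , x~v ∷ x~ys = All.++⁺ x~xs x~ys ∷ p′ , x~v ∷ xs~ , ~ys

  allPairs-insert : ∀ {r} {R : Rel A r} xs {v ys} → AllPairs R (xs ++ ys) →
                    All (λ x → R x v) xs → All (R v) ys → AllPairs R (xs ++ v ∷ ys)
  allPairs-insert []       p        []          ~ys = ~ys ∷ p
  allPairs-insert (x ∷ xs) (x~ ∷ p) (x~v ∷ xs~) ~ys with All.++⁻ xs x~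
  ... | x~xs , x~ys = All.++⁺ x~xs (x~v ∷ x~ys) ∷ allPairs-insert xs p xs~ ~ys

  module _ (_≟_ : DecidableEquality A) where

    insertionsAfter : A → A → List A → List (List A)
    insertionsAfter u v []      = []
    insertionsAfter u v (x ∷ w) with x ≟ u
    ... | yes _ = insertions v (x ∷ w)
    ... | no  _ = map (x ∷_) (insertionsAfter u v w)

    ∈-insertionsAfter⁻ : ∀ {u v} w {w′} → w′ ∈ insertionsAfter u v w → InsertedAfter u v w w′
    ∈-insertionsAfter⁻ {u} (x ∷ w) w′∈ with x ≟ u
    ... | yes refl = ∈-insertions⁻ x w′∈
    ... | no  _ with ∈-map⁻ (x ∷_) w′∈
    ...   | _ , w″∈ , refl = insertedAfter-∷ x (∈-insertionsAfter⁻ w w″∈)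

    ∈-insertionsAfter⁺ : ∀ {u v w w′} → InsertedAfter u v w w′ → w′ ∈ insertionsAfter u v w
    ∈-insertionsAfter⁺ {u} {v} (xs₀ , ys , u∈₀ , refl , refl) = go xs₀ u∈₀
      where
      go : ∀ xs → u ∈ xs → xs ++ v ∷ ys ∈ insertionsAfter u v (xs ++ ys)
      go (x ∷ xs) u∈ with x ≟ u | u∈
      ... | yes _  | _         = ∈-insertions⁺ xs
      ... | no x≢u | here eq   = contradiction (sym eq) x≢u
      ... | no _   | there u∈′ = ∈-map⁺ (x ∷_) (go xs u∈′)

    insertionsAfter-unique : ∀ {u v} w → v ∉ w → Unique (insertionsAfter u v w)
    insertionsAfter-unique []          _  = []
    insertionsAfter-unique {u} (x ∷ w) v∉ with x ≟ u
    ... | yes _ = insertions-unique v∉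
    ... | no  _ = Unique.map⁺ ∷-injectiveʳ (insertionsAfter-unique w (v∉ ∘ there))

module _ {a p} {A : Set a} {P : Set p} {x y : A} where

  if-yes : ∀ (P? : Dec P) → P → (if does P? then x else y) ≡ x
  if-yes P? p = cong (if_then x else y) (dec-true P? p)

  if-no : ∀ (P? : Dec P) → ¬ P → (if does P? then x else y) ≡ y
  if-no P? ¬p = cong (if_then x else y) (dec-false P? ¬p)

-- Products over pairs

-- Stated for a commutative monoid so that the sums and the products of a ring are both instances.
module BigOperator {c ℓ} (M : CommutativeMonoid c ℓ) where
  open CommutativeMonoid M renaming (refl to ≈-refl; trans to ≈-trans; sym to ≈-sym)
  open CommutativeSemigroupProperties commutativeSemigroup using (interchange; x∙yz≈y∙xz)

  module _ {a} {A : Set a} where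

    ⨀ : List A → (A → Carrier) → Carrier
    ⨀ xs f = foldr _∙_ ε (map f xs)

    ⨀-cong : ∀ {xs f g} → All (λ x → f x ≈ g x) xs → ⨀ xs f ≈ ⨀ xs g
    ⨀-cong []         = ≈-refl
    ⨀-cong (eq ∷ eqs) = ∙-cong eq (⨀-cong eqs)

    ⨀-↭ : ∀ {xs ys} f → xs ↭ ys → ⨀ xs f ≈ ⨀ ys f
    ⨀-↭ f ↭.refl         = ≈-refl
    ⨀-↭ f (↭.prep x p)   = ∙-congˡ (⨀-↭ f p)
    ⨀-↭ f (↭.swap x y p) = ≈-trans (∙-congˡ (∙-congˡ (⨀-↭ f p))) (x∙yz≈y∙xz _ _ _)
    ⨀-↭ f (↭.trans p q)  = ≈-trans (⨀-↭ f p) (⨀-↭ f q)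

    ⨀-++ : ∀ xs {ys} f → ⨀ (xs ++ ys) f ≈ ⨀ xs f ∙ ⨀ ys f
    ⨀-++ []       f = ≈-sym (identityˡ _)
    ⨀-++ (x ∷ xs) f = ≈-trans (∙-congˡ (⨀-++ xs f)) (≈-sym (assoc _ _ _))

    ⨀-∙ : ∀ xs f g → ⨀ xs (λ x → f x ∙ g x) ≈ ⨀ xs f ∙ ⨀ xs g
    ⨀-∙ []       f g = ≈-sym (identityˡ ε)
    ⨀-∙ (x ∷ xs) f g = ≈-trans (∙-congˡ (⨀-∙ xs f g)) (interchange _ _ _ _)

    ⨀-filter : ∀ {q} {P : A → Set q} (P? : Decidable P) xs f →
               ⨀ (filter P? xs) f ≈ ⨀ xs (λ x → if does (P? x) then f x else ε)
    ⨀-filter P? []       f = ≈-refl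
    ⨀-filter P? (x ∷ xs) f with does (P? x)
    ... | true  = ∙-congˡ (⨀-filter P? xs f)
    ... | false = ≈-trans (⨀-filter P? xs f) (≈-sym (identityˡ _))

    -- The earlier entry of a pair is the first argument of `f`. Unless `f` is symmetric, the value
    -- depends on the order of the list; this is how the sign of a permutation's summand is
    -- expressed.
    ⨀₂ : List A → (A → A → Carrier) → Carrier
    ⨀₂ []       f = ε
    ⨀₂ (x ∷ xs) f = ⨀ xs (f x) ∙ ⨀₂ xs f

    ⨀₂-cong : ∀ {xs f g} → AllPairs (λ x y → f x y ≈ g x y) xs → ⨀₂ xs f ≈ ⨀₂ xs g
    ⨀₂-cong []         = ≈-refl
    ⨀₂-cong (eq ∷ eqs) = ∙-cong (⨀-cong eq) (⨀₂-cong eqs)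

    ⨀₂-↭ : ∀ {xs ys f} → (∀ x y → f x y ≈ f y x) → xs ↭ ys → ⨀₂ xs f ≈ ⨀₂ ys f
    ⨀₂-↭ f-sym ↭.refl         = ≈-refl
    ⨀₂-↭ f-sym (↭.prep x p)   = ∙-cong (⨀-↭ _ p) (⨀₂-↭ f-sym p)
    ⨀₂-↭ f-sym (↭.trans p q)  = ≈-trans (⨀₂-↭ f-sym p) (⨀₂-↭ f-sym q)
    -- Exchanging two neighbours reverses a single pair, and `f-sym` takes care of it.
    ⨀₂-↭ {f = f} f-sym (↭.swap {xs} {ys} x y p) = ≈-trans (interchange _ _ _ _)
      (∙-cong (∙-cong (f-sym x y) (⨀-↭ (f y) p)) (∙-cong (⨀-↭ (f x) p) (⨀₂-↭ f-sym p)))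

  ⨀-map : ∀ {a b} {A : Set a} {B : Set b} (g : A → B) xs f → ⨀ (map g xs) f ≈ ⨀ xs (f ∘ g)
  ⨀-map g []       f = ≈-refl
  ⨀-map g (x ∷ xs) f = ∙-congˡ (⨀-map g xs f)

  ⨀-concatMap : ∀ {a b} {A : Set a} {B : Set b} (g : A → List B) xs f →
                ⨀ (concatMap g xs) f ≈ ⨀ xs (λ x → ⨀ (g x) f)
  ⨀-concatMap g []       f = ≈-refl
  ⨀-concatMap g (x ∷ xs) f = ≈-trans (⨀-++ (g x) f) (∙-congˡ (⨀-concatMap g xs f))

  module _ {a b} {A : Set a} {B : Set b} where

    ⨀-tabulate-cong : ∀ {m} (f : Fin m → A) (h : Fin m → B) {F H} →
                      (∀ i → F (f i) ≈ H (h i)) → ⨀ (tabulate f) F ≈ ⨀ (tabulate h) H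
    ⨀-tabulate-cong {zero}  f h eq = ≈-refl
    ⨀-tabulate-cong {suc m} f h eq = ∙-cong (eq zero) (⨀-tabulate-cong (f ∘ suc) (h ∘ suc) (eq ∘ suc))

    ⨀₂-tabulate-cong : ∀ {m} (f : Fin m → A) (h : Fin m → B) {F H} →
                       (∀ i j → F (f i) (f j) ≈ H (h i) (h j)) → ⨀₂ (tabulate f) F ≈ ⨀₂ (tabulate h) H
    ⨀₂-tabulate-cong {zero}  f h eq = ≈-refl
    ⨀₂-tabulate-cong {suc m} f h eq = ∙-cong
      (⨀-tabulate-cong (f ∘ suc) (h ∘ suc) (λ j → eq zero (suc j)))
      (⨀₂-tabulate-cong (f ∘ suc) (h ∘ suc) (λ i j → eq (suc i) (suc j)))

  -- In an increasing list `i < j` means that `i` stands earlier. The row of the first entry `x`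
  -- loses only its diagonal place, and the column of `x` contributes nothing to the later rows.
  ⨀-increasing : ∀ {m} {is : List (Fin m)} → AllPairs _<_ is → (f : Fin m → Fin m → Carrier) →
                 ⨀ is (λ i → ⨀ is (λ j → if does (i Fin.<? j) then f i j else ε)) ≈ ⨀₂ is f
  ⨀-increasing []                 f = ≈-refl
  ⨀-increasing {is = x ∷ is} (x< ∷ is<) f = ∙-cong
    (≈-trans (∙-cong (skip (Fin.<-irrefl refl)) (⨀-cong (All.map keep x<))) (identityˡ _))
    (≈-trans (⨀-cong (All.map (λ x<i → ≈-trans (∙-congʳ (skip (Fin.<-asym x<i))) (identityˡ _)) x<)) (⨀-increasing is< f))
    where
    skip : ∀ {i j} → ¬ i < j → (if does (i Fin.<? j) then f i j else ε) ≈ ε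
    skip {i} {j} i≮j = reflexive (if-no (i Fin.<? j) i≮j)

    keep : ∀ {i j} → i < j → (if does (i Fin.<? j) then f i j else ε) ≈ f i j
    keep {i} {j} i<j = reflexive (if-yes (i Fin.<? j) i<j)

  -- `edges` scans the square of all vertex pairs row by row and keeps the increasing ones, so this
  -- is `⨀-increasing` for the increasing list `allFin`.
  ⨀-edges : ∀ n (f : V n → V n → Carrier) → ⨀ (edges n) (λ e → f (tail e) (head e)) ≈ ⨀₂ (allFin (suc n)) f
  ⨀-edges n f = ≈-trans (⨀-concatMap (λ i → mapMaybe (edge? i) (allFin (suc n))) (allFin (suc n)) _)
    (≈-trans (⨀-cong {xs = allFin (suc n)} (All.tabulate λ {i} _ → row i (allFin (suc n))))
      (⨀-increasing (AllPairs.tabulate⁺-< id) f))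
    where
    row : ∀ i js → ⨀ (mapMaybe (edge? i) js) (λ e → f (tail e) (head e)) ≈
                   ⨀ js (λ j → if does (i Fin.<? j) then f i j else ε)
    row i []       = ≈-refl
    row i (j ∷ js) with i Fin.<? j
    ... | yes i<j = ∙-cong (reflexive (sym (if-yes (i Fin.<? j) i<j))) (row i js)
    ... | no  i≮j = ≈-trans (row i js)
      (≈-trans (≈-sym (identityˡ _)) (∙-congʳ (reflexive (sym (if-no (i Fin.<? j) i≮j)))))

-- Inserting a leaf

-- Later `ε` is the sign of a pair and `φ` its factor in `p (∁ T)`, both 1 on the edges of the tree.
-- Only the relations in `Detached` and these values at the edge to the leaf enter here.
module LeafInsertion {c ℓ} (R : CommutativeRing c ℓ) {i} {A : Set i} (_≟_ : DecidableEquality A)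
  (t : A → CommutativeRing.Carrier R) (ε φ : A → A → CommutativeRing.Carrier R) where

  open CommutativeRing R hiding (zero) renaming (refl to ≈-refl; sym to ≈-sym; trans to ≈-trans)
  open RingProperties ring using (-‿distribˡ-*; -‿distribʳ-*; -‿+-comm; -‿involutive)
  open SetoidReasoning setoid
  module S = SemiringSolver commutativeSemiring
  module ⨁ = BigOperator +-commutativeMonoid
  module ⨂ = BigOperator *-commutativeMonoid
  open ⨁ using () renaming (⨀ to ∑)
  open ⨂ using () renaming (⨀ to ∏; ⨀₂ to ∏₂)

  *-distribˡ-∑ : ∀ {b} {B : Set b} x (ys : List B) f → ∑ ys (λ y → x * f y) ≈ x * ∑ ys f
  *-distribˡ-∑ x []       f = ≈-sym (zeroʳ x)
  *-distribˡ-∑ x (y ∷ ys) f = ≈-trans (+-congˡ (*-distribˡ-∑ x ys f)) (≈-sym (distribˡ x _ _))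

  d : A → A → Carrier
  d x y = t y - t x

  d-split : ∀ x y z → d y z ≈ - d x y + d x z
  d-split x y z = ≈-sym (begin
    - (t y - t x) + (t z - t x)      ≈⟨ +-congʳ (-‿+-comm _ _) ⟨
    (- t y - - t x) + (t z - t x)    ≈⟨ +-congʳ (+-congˡ (-‿involutive _)) ⟩
    (- t y + t x) + (t z - t x)      ≈⟨ S.solve 4 (λ a b c e → (a S.:+ b) S.:+ (c S.:+ e) S.:= (c S.:+ a) S.:+ (b S.:+ e)) ≈-refl _ _ _ _ ⟩
    (t z - t y) + (t x - t x)        ≈⟨ +-congˡ (-‿inverseʳ (t x)) ⟩
    (t z - t y) + 0#                 ≈⟨ +-identityʳ _ ⟩
    t z - t y                        ∎)

  d-anti : ∀ x y → d y x ≈ - d x y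
  d-anti x y = ≈-trans (d-split x y x) (≈-trans (+-congˡ (-‿inverseʳ (t x))) (+-identityʳ _))

  -- 𝐏 along the sequence w.
  gaps : List A → Carrier
  gaps []      = 1#
  gaps (x ∷ w) = ∏ (drop 1 w) (d x) * gaps w

  -- At `sequence s` this is the summand of a compatible `s`: the pair signs multiply to the power
  -- of -1 and `gaps` is 𝐏.
  term : List A → Carrier
  term w = ∏₂ w ε * gaps w

  -- The contribution of a new first entry `x`. Its pair with the first entry of `w` is consecutive,
  -- so it has a sign but no difference.
  term-head : A → List A → Carrier
  term-head x w = ∏ w (ε x) * ∏ (drop 1 w) (d x)

  term-∷ : ∀ x w → term (x ∷ w) ≈ term-head x w * term w
  term-∷ x w = S.solve 4 (λ a b c e → (a S.:* b) S.:* (c S.:* e) S.:= (a S.:* c) S.:* (b S.:* e)) ≈-refl _ _ _ _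

  -- The insertion leaves the first entry of `w` in place, so the pair without a difference stays
  -- the same, and `v` adds both its sign and its difference.
  term-head-inserted : ∀ {u v w w′} x → InsertedAfter u v w w′ →
                       term-head x w′ ≈ ε x v * d x v * term-head x w
  term-head-inserted x i = ≈-trans
    (*-cong (⨂.⨀-↭ (ε x) (insertedAfter-↭ i)) (⨂.⨀-↭ (d x) (insertedAfter-drop-↭ i)))
    (S.solve 4 (λ a b c e → (a S.:* b) S.:* (c S.:* e) S.:= (a S.:* c) S.:* (b S.:* e)) ≈-refl _ _ _ _)

  -- The contribution of `x` does not depend on where `v` is inserted behind it and comes out of the
  -- sum.
  ∑-map-∷ : ∀ {u v w ws} x → All (InsertedAfter u v w) ws →
            ∑ (map (x ∷_) ws) term ≈ ε x v * d x v * term-head x w * ∑ ws term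
  ∑-map-∷ {ws = ws} x is = ≈-trans (⨁.⨀-map (x ∷_) ws term) (≈-trans
    (⨁.⨀-cong (All.map (λ {w′} i → ≈-trans (term-∷ x w′) (*-congʳ (term-head-inserted x i))) is))
    (*-distribˡ-∑ _ ws term))

  -- What the leaf v needs from a vertex x other than its parent.
  record Detached (v x : A) : Set ℓ where
    field
      ε-anti : ε v x ≈ - ε x v
      φ≈     : φ x v ≈ ε x v * d x v

    φ≈′ : φ x v ≈ ε v x * d v x
    φ≈′ = begin
      φ x v                  ≈⟨ φ≈ ⟩
      ε x v * d x v          ≈⟨ -‿involutive _ ⟨
      - - (ε x v * d x v)    ≈⟨ -‿cong (-‿distribʳ-* _ _) ⟩
      - (ε x v * - d x v)    ≈⟨ -‿distribˡ-* _ _ ⟩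
      - ε x v * - d x v      ≈⟨ *-cong ε-anti (d-anti x v) ⟨
      ε v x * d v x          ∎

  open Detached

  -- Adding the insertions from right to left, each partial sum is again a single
  -- product: the step is d y v = d x v - d x y, where y follows x.
  ∑-insertions : ∀ {v} x w → All (Detached v) w →
    ∑ (insertions v (x ∷ w)) term ≈ ε x v * term (x ∷ w) * ∏ w (λ y → φ y v)
  -- Here `v` is consecutive to `x`, so only the sign `ε x v` is left.
  ∑-insertions {v} x [] [] =
    S.solve 1 (λ a → (((a S.:* S.con 1) S.:* (S.con 1 S.:* S.con 1)) S.:* (S.con 1 S.:* (S.con 1 S.:* S.con 1))) S.:+ S.con 0
      S.:= (a S.:* ((S.con 1 S.:* S.con 1) S.:* (S.con 1 S.:* S.con 1))) S.:* S.con 1) ≈-refl (ε x v)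
  ∑-insertions {v} x w@(y ∷ z) (dy ∷ dz) = begin
    term (x ∷ v ∷ w) + ∑ (map (x ∷_) (insertions v w)) term
      -- The first summand has `v` between `x` and `y`. In all others `y` still follows `x`, and
      -- induction sums them with `y` in the role of `x`.
      ≈⟨ +-cong front (≈-trans (∑-map-∷ x (All.tabulate (∈-insertions⁻ {w = z} y))) (*-congˡ (∑-insertions y z dz))) ⟩
    (a * P) * (d x y * D) * (- b * Φ * τ) + a * d x v * (P * D) * (b * τ * Φ)
      -- The solver knows only semirings, so the minus sign is first moved onto `d x y`, where
      -- `d-split` has it.
      ≈⟨ +-congʳ (negate (d x y) b) ⟩
    (a * P) * (- d x y * D) * (b * Φ * τ) + a * d x v * (P * D) * (b * τ * Φ)
      ≈⟨ S.solve 8 (λ a P g D b Φ τ h →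
           (a S.:* P) S.:* (g S.:* D) S.:* (b S.:* Φ S.:* τ) S.:+ a S.:* h S.:* (P S.:* D) S.:* (b S.:* τ S.:* Φ)
           S.:= a S.:* ((P S.:* D) S.:* τ) S.:* ((b S.:* (g S.:+ h)) S.:* Φ)) ≈-refl a P (- d x y) D b Φ τ (d x v) ⟩
    a * ((P * D) * τ) * (b * (- d x y + d x v) * Φ)
      ≈⟨ *-cong (*-congˡ (term-∷ x w)) (*-congʳ (≈-trans (φ≈ dy) (*-congˡ (d-split x y v)))) ⟨
    a * term (x ∷ w) * (φ y v * Φ) ∎
    where
    a b P D Φ τ : Carrier
    a = ε x v
    b = ε y v
    P = ∏ w (ε x)
    D = ∏ z (d x)
    Φ = ∏ z (λ y → φ y v)
    τ = term w

    negate : ∀ g b → (a * P) * (g * D) * (- b * Φ * τ) ≈ (a * P) * (- g * D) * (b * Φ * τ)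
    negate g b = begin
      (a * P) * (g * D) * (- b * Φ * τ)
        ≈⟨ S.solve 6 (λ q g D b Φ τ → q S.:* (g S.:* D) S.:* (b S.:* Φ S.:* τ) S.:= q S.:* D S.:* Φ S.:* τ S.:* (g S.:* b))
             ≈-refl (a * P) g D (- b) Φ τ ⟩
      a * P * D * Φ * τ * (g * - b)
        ≈⟨ *-congˡ (≈-trans (≈-sym (-‿distribʳ-* g b)) (-‿distribˡ-* g b)) ⟩
      a * P * D * Φ * τ * (- g * b)
        ≈⟨ S.solve 6 (λ q g D b Φ τ → q S.:* (g S.:* D) S.:* (b S.:* Φ S.:* τ) S.:= q S.:* D S.:* Φ S.:* τ S.:* (g S.:* b))
             ≈-refl (a * P) (- g) D b Φ τ ⟨
      (a * P) * (- g * D) * (b * Φ * τ) ∎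

    front : term (x ∷ v ∷ w) ≈ (a * P) * (d x y * D) * (- b * Φ * τ)
    front = begin
      term (x ∷ v ∷ w)
        ≈⟨ ≈-trans (term-∷ x (v ∷ w)) (*-congˡ (term-∷ v w)) ⟩
      (a * P) * (d x y * D) * ((ε v y * ∏ z (ε v)) * ∏ z (d v) * τ)
        -- The pair of `v` and `y` is consecutive and contributes only a sign; with every later
        -- vertex, the sign and the difference of `v` combine to `φ`.
        ≈⟨ *-congˡ (*-congʳ (≈-trans (*-assoc _ _ _) (*-cong (ε-anti dy)
             (≈-trans (≈-sym (⨂.⨀-∙ z (ε v) (d v))) (⨂.⨀-cong (All.map (≈-sym ∘ φ≈′) dz)))))) ⟩
      (a * P) * (d x y * D) * (- b * Φ * τ) ∎

  -- A vertex `x` in front of `u` precedes `v` in every insertion and contributes `φ x v` each time.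
  -- From `u` on `∑-insertions` applies, and `ε u v` is traded for `φ u v`, both being 1.
  ∑-insertionsAfter : ∀ {u v} w → u ∈ w → Unique w → ε u v ≈ 1# → φ u v ≈ 1# →
    (∀ {x} → x ∈ w → x ≢ u → Detached v x) →
    ∑ (insertionsAfter _≟_ u v w) term ≈ term w * ∏ w (λ x → φ x v)
  ∑-insertionsAfter {u} {v} (x ∷ w) u∈ (x∉ ∷ w!) ε≈1 φ≈1 det with x ≟ u | u∈
  ... | yes refl | _ = begin
    ∑ (insertions v (x ∷ w)) term
      ≈⟨ ∑-insertions x w (All.tabulate λ y∈ → det (there y∈) (All.lookup x∉ y∈ ∘ sym)) ⟩
    ε u v * term (x ∷ w) * ∏ w (λ y → φ y v)
      ≈⟨ *-congʳ (≈-trans (*-comm _ _) (*-congˡ (≈-trans ε≈1 (≈-sym φ≈1)))) ⟩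
    term (x ∷ w) * φ u v * ∏ w (λ y → φ y v)
      ≈⟨ *-assoc _ _ _ ⟩
    term (x ∷ w) * (φ u v * ∏ w (λ y → φ y v)) ∎
  ... | no x≢u | here u≡x = contradiction (sym u≡x) x≢u
  ... | no x≢u | there u∈′ = begin
    ∑ (map (x ∷_) (insertionsAfter _≟_ u v w)) term
      ≈⟨ ∑-map-∷ x (All.tabulate (∈-insertionsAfter⁻ _≟_ w)) ⟩
    ε x v * d x v * term-head x w * ∑ (insertionsAfter _≟_ u v w) term
      ≈⟨ *-cong (*-congʳ (≈-sym (φ≈ (det (here refl) x≢u)))) (∑-insertionsAfter w u∈′ w! ε≈1 φ≈1 (det ∘ there)) ⟩
    φ x v * term-head x w * (term w * ∏ w (λ y → φ y v))
      ≈⟨ S.solve 4 (λ a b c e → (a S.:* b) S.:* (c S.:* e) S.:= (b S.:* c) S.:* (a S.:* e)) ≈-refl _ _ _ _ ⟩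
    term-head x w * term w * (φ x v * ∏ w (λ y → φ y v))
      ≈⟨ *-congʳ (term-∷ x w) ⟨
    term (x ∷ w) * (φ x v * ∏ w (λ y → φ y v)) ∎

-- Growing a spanning tree from its root

lookup-injective : ∀ {a} {A : Set a} {xs : List A} → Unique xs → ∀ {i j} → lookup xs i ≡ lookup xs j → i ≡ j
lookup-injective (_ ∷ _)  {zero}  {zero}  _  = refl
lookup-injective (p ∷ _)  {zero}  {suc j} eq = contradiction eq (All.lookup p (∈-lookup j))
lookup-injective (p ∷ _)  {suc i} {zero}  eq = contradiction (sym eq) (All.lookup p (∈-lookup i))
lookup-injective (_ ∷ u)  {suc i} {suc j} eq = cong suc (lookup-injective u eq)

module _ {n : ℕ} where
  open DecMembership (Fin._≟_ {suc n}) using (_∈?_)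

  adjacent-sym : ∀ (Y : EdgeSet n) {i j} → Adjacent Y i j → Adjacent Y j i
  adjacent-sym Y (e , y , joins) = e , y , swap joins

  path-snoc : ∀ {Y : EdgeSet n} {i j k vs} → Path Y i j vs → Adjacent Y j k → k ∉ vs → Path Y i k (vs ∷ʳ k)
  path-snoc stop                             jk k∉ = step jk (λ { (here refl) → k∉ (here refl) }) stop
  path-snoc (step {i} {vs = vs} ij i∉ p) jk k∉ = step ij i∉′ (path-snoc p jk (k∉ ∘ there))
    where
    i∉′ : i ∉ vs ∷ʳ _
    i∉′ i∈ with ∈-++⁻ vs i∈
    ... | inj₁ i∈vs        = i∉ i∈vs
    ... | inj₂ (here refl) = k∉ (here refl)

  path-crossing : ∀ {Y : EdgeSet n} S {i j vs} → Path Y i j vs → i ∈ S → j ∉ S →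
                  ∃₂ λ u v → u ∈ S × v ∉ S × Adjacent Y u v
  path-crossing S stop i∈ j∉ = contradiction i∈ j∉
  path-crossing S (step {i} {k} ik _ p) i∈ j∉ with k ∈? S
  ... | yes k∈ = path-crossing S p k∈ j∉
  ... | no k∉  = i , k , i∈ , k∉ , ik

  module _ (T : EdgeSet n) where

    -- The vertices of a subtree containing 0, the last added leaf first.
    data Growth : List (V n) → Set where
      root : Growth (zero ∷ [])
      leaf : ∀ {S u v} → Growth S → u ∈ S → v ∉ S → Adjacent T u v →
             (∀ {x} → x ∈ S → Adjacent T x v → x ≡ u) → Growth (v ∷ S)

    -- The tree edges directed away from 0. Once `S` contains all vertices, they generate
    -- `Precedes T`, so linear extensions can be tested on them without mentioning paths.
    Parent : ∀ {S} → Growth S → V n → V n → Set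
    Parent root                      i j = ⊥
    Parent (leaf {u = u} {v} g _ _ _ _) i j = Parent g i j ⊎ (i ≡ u × j ≡ v)

    zero∈ : ∀ {S} → Growth S → zero ∈ S
    zero∈ root             = here refl
    zero∈ (leaf g _ _ _ _) = there (zero∈ g)

    growth-unique : ∀ {S} → Growth S → Unique S
    growth-unique root              = [] ∷ []
    growth-unique (leaf g _ v∉ _ _) = All.¬Any⇒All¬ _ v∉ ∷ growth-unique g

    parent-∈ˡ : ∀ {S i j} (g : Growth S) → Parent g i j → i ∈ S
    parent-∈ˡ (leaf g u∈ _ _ _) (inj₁ p)             = there (parent-∈ˡ g p)
    parent-∈ˡ (leaf g u∈ _ _ _) (inj₂ (refl , refl)) = there u∈

    parent-∈ʳ : ∀ {S i j} (g : Growth S) → Parent g i j → j ∈ S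
    parent-∈ʳ (leaf g _ _ _ _) (inj₁ p)             = there (parent-∈ʳ g p)
    parent-∈ʳ (leaf g _ _ _ _) (inj₂ (refl , refl)) = here refl

    parent-≢zero : ∀ {S i} (g : Growth S) → ¬ Parent g i zero
    parent-≢zero (leaf g _ _ _ _)  (inj₁ p)             = parent-≢zero g p
    parent-≢zero (leaf g _ v∉ _ _) (inj₂ (_ , refl)) = v∉ (zero∈ g)

    parent-unique : ∀ {S i i′ j} (g : Growth S) → Parent g i j → Parent g i′ j → i ≡ i′
    parent-unique (leaf g _ _ _ _)  (inj₁ p)          (inj₁ q)          = parent-unique g p q
    parent-unique (leaf g _ v∉ _ _) (inj₁ p)          (inj₂ (_ , refl)) = contradiction (parent-∈ʳ g p) v∉
    parent-unique (leaf g _ v∉ _ _) (inj₂ (_ , refl)) (inj₁ q)          = contradiction (parent-∈ʳ g q) v∉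
    parent-unique (leaf g _ _ _ _)  (inj₂ (refl , _)) (inj₂ (refl , _)) = refl

    ¬adjacent-refl : ∀ {i} → ¬ Adjacent T i i
    ¬adjacent-refl {i} (edge _ _ p , _ , inj₁ (refl , refl)) = Fin.<-irrefl refl (recompute (i Fin.<? i) p)
    ¬adjacent-refl {i} (edge _ _ p , _ , inj₂ (refl , refl)) = Fin.<-irrefl refl (recompute (i Fin.<? i) p)

    -- When the later of the two ends was added, the other end was already present and hence was its
    -- unique neighbour.
    adjacent-parent : ∀ {S i j} (g : Growth S) → i ∈ S → j ∈ S → Adjacent T i j → Parent g i j ⊎ Parent g j i
    adjacent-parent root (here refl) (here refl) a = ⊥-elim (¬adjacent-refl a)
    adjacent-parent (leaf g _ _ _ _)  (here refl) (here refl) a = ⊥-elim (¬adjacent-refl a)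
    adjacent-parent (leaf g _ _ _ !u) (here refl) (there j∈)  a = inj₂ (inj₂ (!u j∈ (adjacent-sym T a) , refl))
    adjacent-parent (leaf g _ _ _ !u) (there i∈)  (here refl) a = inj₁ (inj₂ (!u i∈ a , refl))
    adjacent-parent (leaf g _ _ _ _)  (there i∈)  (there j∈)  a with adjacent-parent g i∈ j∈ a
    ... | inj₁ p = inj₁ (inj₁ p)
    ... | inj₂ p = inj₂ (inj₁ p)

    -- Staying inside `S` keeps the path simple when a vertex outside `S` is attached to one of its
    -- ends.
    growth-path : ∀ {S i j} → Growth S → i ∈ S → j ∈ S → ∃[ vs ] Path T i j vs × All (_∈ S) vs
    growth-path root (here refl) (here refl) = _ , stop , here refl ∷ []
    growth-path (leaf g _ _ _ _) (here refl) (here refl) = _ , stop , here refl ∷ []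
    growth-path (leaf g u∈ v∉ a _) (here refl) (there j∈) with growth-path g u∈ j∈
    ... | _ , p , vs∈ = _ , step (adjacent-sym T a) (v∉ ∘ All.lookup vs∈) p , here refl ∷ All.map there vs∈
    growth-path (leaf g u∈ v∉ a _) (there i∈) (here refl) with growth-path g i∈ u∈
    ... | _ , p , vs∈ = _ , path-snoc p a (v∉ ∘ All.lookup vs∈) , All.∷ʳ⁺ (All.map there vs∈) (here refl)
    growth-path (leaf g _ _ _ _) (there i∈) (there j∈) with growth-path g i∈ j∈
    ... | _ , p , vs∈ = _ , p , All.map there vs∈

    -- A second neighbour of v in S would close a cycle through v.
    neighbour-unique : ¬ Cycle T → ∀ {S u v x} → Growth S → u ∈ S → v ∉ S → Adjacent T u v →
                       x ∈ S → Adjacent T x v → x ≡ u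
    neighbour-unique acyclic {u = u} {v} {x} g u∈ v∉ uv x∈ xv with growth-path g u∈ x∈
    ... | _ , stop , _ = refl
    ... | _ , p@(step _ _ q) , vs∈ = contradiction
      (v , x , _ , step (adjacent-sym T uv) (v∉ ∘ All.lookup vs∈) p , s≤s (s≤s (path-nonempty q)) , xv) acyclic
      where
      path-nonempty : ∀ {i j vs} → Path T i j vs → 1 ℕ.≤ length vs
      path-nonempty stop         = s≤s z≤n
      path-nonempty (step _ _ _) = s≤s z≤n

    -- While a vertex is missing, the path to it from 0 yields an edge leaving `S`, and acyclicity
    -- makes the outer end of this edge a leaf.
    spanning-growth : IsSpanningTree T → ∃[ S ] Growth S × (∀ i → i ∈ S)
    spanning-growth (connected , acyclic) = extend-growth n root (ℕ.+-comm n 1)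
      where
      -- `k` is the number of vertices still missing.
      extend-growth : ∀ k {S} → Growth S → k ℕ.+ length S ≡ suc n → ∃[ S ] Growth S × (∀ i → i ∈ S)
      extend-growth k {S} g len with Fin.any? (λ i → ¬? (i ∈? S))
      ... | no ∄∉ = S , g , λ i → decidable-stable (i ∈? S) λ i∉ → ∄∉ (i , i∉)
      ... | yes (i , i∉) with path-crossing S (let _ , p = connected zero i in p) (zero∈ g) i∉
      ...   | u , v , u∈ , v∉ , uv with leaf g u∈ v∉ uv (neighbour-unique acyclic g u∈ v∉ uv)
      ...     | g′ with k
      ...       | suc k′ = extend-growth k′ g′ (trans (ℕ.+-suc k′ _) len)
      -- With nothing missing, `g′` would list n + 2 distinct vertices.
      ...       | zero   = contradiction (Fin.injective⇒≤ (lookup-injective (growth-unique g′))) (ℕ.<⇒≱ (s≤s (ℕ.≤-reflexive (sym len))))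

-- Linear extensions and compatibility

does-true : ∀ {p} {P : Set p} (P? : Dec P) → does P? ≡ true → P
does-true (yes p) _ = p

allPairs-map-∈ : ∀ {a r r′} {A : Set a} {R : Rel A r} {R′ : Rel A r′} {w} →
                 (∀ {x y} → x ∈ w → R x y → R′ x y) → AllPairs R w → AllPairs R′ w
allPairs-map-∈ h []       = []
allPairs-map-∈ h (x~ ∷ p) = All.map (h (here refl)) x~ ∷ allPairs-map-∈ (h ∘ there) p

allPairs-tabulate⁻ : ∀ {a r m} {A : Set a} {R : Rel A r} {f : Fin m → A} →
                     AllPairs R (tabulate f) → ∀ {i j} → i < j → R (f i) (f j)
allPairs-tabulate⁻ (x~ ∷ p) {zero}  {suc j} _         = All.tabulate⁻ x~ j
allPairs-tabulate⁻ (x~ ∷ p) {suc i} {suc j} (s≤s i<j) = allPairs-tabulate⁻ p i<j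

unique-resp-↭ : ∀ {a} {A : Set a} {xs ys : List A} → xs ↭ ys → Unique xs → Unique ys
unique-resp-↭ p = Unique-resp-↭ (≡.setoid _) (↭⇒↭ₛ p)

unique-++-disjoint : ∀ {a} {A : Set a} xs {ys : List A} → Unique (xs ++ ys) → Disjoint xs ys
unique-++-disjoint (x ∷ xs) (x∉ ∷ _) (here refl , ∈ys) = All.lookup x∉ (∈-++⁺ʳ xs ∈ys) refl
unique-++-disjoint (x ∷ xs) (_ ∷ u)  (there ∈xs , ∈ys) = unique-++-disjoint xs u (∈xs , ∈ys)

module _ {n : ℕ} (T : EdgeSet n) where

  -- Generated along the growth, so that the sum over the list can be evaluated leaf by leaf;
  -- `IsLinearExtension` is the description independent of this recursion.
  linearExtensions : ∀ {S} → Growth T S → List (List (V n))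
  linearExtensions root                       = (zero ∷ []) ∷ []
  linearExtensions (leaf {u = u} {v} g _ _ _ _) = concatMap (insertionsAfter Fin._≟_ u v) (linearExtensions g)

  record IsLinearExtension {S} (g : Growth T S) (w : List (V n)) : Set where
    constructor isLinearExtension
    field
      arranges   : w ↭ S
      rooted     : ∃[ w₀ ] w ≡ zero ∷ w₀
      respecting : AllPairs (λ x y → ¬ Parent T g y x) w

  open IsLinearExtension public

  -- Inserting `v` creates no violation: `v` has no child that could stand in front of it, and its
  -- parent `u` is in the prefix, hence not behind it, as nothing is repeated.
  ∈-linearExtensions⁻ : ∀ {S w} (g : Growth T S) → w ∈ linearExtensions g → IsLinearExtension g w
  ∈-linearExtensions⁻ root (here refl) = isLinearExtension ↭-refl ([] , refl) ([] ∷ [])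
  ∈-linearExtensions⁻ (leaf {S} {u} {v} g u∈ v∉ _ _) w∈
    with find (∈-concatMap⁻ (insertionsAfter Fin._≟_ u v) {xs = linearExtensions g} w∈)
  ... | w₀ , w₀∈ , w∈′
    with ∈-insertionsAfter⁻ Fin._≟_ w₀ w∈′ | ∈-linearExtensions⁻ g w₀∈
  ... | i@(x ∷ xs , ys , u∈xs , refl , refl) | isLinearExtension w₀↭ (_ , refl) ok = isLinearExtension
    (↭-trans (insertedAfter-↭ i) (prep v w₀↭)) (_ , refl)
    (allPairs-insert (x ∷ xs)
      (allPairs-map-∈ (λ x∈ ¬p → λ { (inj₁ p) → ¬p p ; (inj₂ (_ , refl)) → v∉w₀ x∈ }) ok)
      (All.tabulate λ x∈ → λ { (inj₁ p) → v∉ (parent-∈ˡ T g p) ; (inj₂ (refl , _)) → v∉ u∈ })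
      (All.tabulate λ y∈ → λ { (inj₁ p) → v∉ (parent-∈ʳ T g p) ; (inj₂ (refl , _)) → u∉ys y∈ }))
    where
    v∉w₀ : v ∉ x ∷ xs ++ ys
    v∉w₀ v∈ = v∉ (∈-resp-↭ w₀↭ v∈)
    u∉ys : u ∉ ys
    u∉ys ∈ys = unique-++-disjoint (x ∷ xs) (unique-resp-↭ (↭-sym w₀↭) (growth-unique T g)) (u∈xs , ∈ys)

  -- Deleting the leaf `v` leaves a linear extension of the smaller tree. Its parent `u` cannot
  -- stand behind `v`, so `v` was inserted after `u`.
  ∈-linearExtensions⁺ : ∀ {S w} (g : Growth T S) → IsLinearExtension g w → w ∈ linearExtensions g
  ∈-linearExtensions⁺ root (isLinearExtension w↭ _ _) = here (↭-singleton-inv w↭)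
  ∈-linearExtensions⁺ (leaf {S} {u} {v} g u∈ v∉ _ _) (isLinearExtension w↭ r ok)
    with xs , ys , refl ← ∈-∃++ (∈-resp-↭ (↭-sym w↭) (here refl))
    with ok′ , _ , ¬v~ ← allPairs-delete xs ok
    with w₀↭ ← drop-mid xs [] w↭
    with ∈-++⁻ xs (∈-resp-↭ (↭-sym w₀↭) u∈)
  ... | inj₂ u∈ys = contradiction (inj₂ (refl , refl)) (All.lookup ¬v~ u∈ys)
  ... | inj₁ u∈xs = ∈-concatMap⁺ (insertionsAfter Fin._≟_ u v) (lose
    (∈-linearExtensions⁺ g (isLinearExtension w₀↭ (rooted⁻ xs u∈xs r) (AllPairs.map (_∘ inj₁) ok′)))
    (∈-insertionsAfter⁺ Fin._≟_ (xs , ys , u∈xs , refl , refl)))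
    where
    -- The prefix contains `u`, so the leading 0 belongs to it and survives the deletion.
    rooted⁻ : ∀ xs {ys zs} → u ∈ xs → ∃[ w₀ ] xs ++ ys ≡ zero ∷ w₀ → ∃[ w₀ ] xs ++ zs ≡ zero ∷ w₀
    rooted⁻ (_ ∷ _) _ (_ , refl) = _ , refl

  -- Insertions into one list are distinct, and different lists share no insertion, since deleting
  -- `v` recovers the list.
  linearExtensions-unique : ∀ {S} (g : Growth T S) → Unique (linearExtensions g)
  linearExtensions-unique root = [] ∷ []
  linearExtensions-unique (leaf {S} {u} {v} g _ v∉ _ _) = Unique.concat⁺
    (All.map⁺ (All.tabulate λ {w} w∈ → insertionsAfter-unique Fin._≟_ w (v∉w w∈)))
    (AllPairs.map⁺ (distinct (λ w∈ → v∉w w∈) (linearExtensions-unique g)))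
    where
    v∉w : ∀ {w} → w ∈ linearExtensions g → v ∉ w
    v∉w w∈ = v∉ ∘ ∈-resp-↭ (arranges (∈-linearExtensions⁻ g w∈))

    distinct : ∀ {ws} → (∀ {w} → w ∈ ws → v ∉ w) → Unique ws →
               AllPairs (λ w₁ w₂ → Disjoint (insertionsAfter Fin._≟_ u v w₁) (insertionsAfter Fin._≟_ u v w₂)) ws
    distinct v∉ []         = []
    distinct v∉ (w∉ ∷ ws!) = All.tabulate (λ w₂∈ (i₁ , i₂) → All.lookup w∉ w₂∈
        (insertedAfter-injective (v∉ (here refl)) (v∉ (there w₂∈))
          (∈-insertionsAfter⁻ Fin._≟_ _ i₁) (∈-insertionsAfter⁻ Fin._≟_ _ i₂)))
      ∷ distinct (v∉ ∘ there) ws!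

-- Precedence in a rooted tree

source∈ : ∀ {n} {Y : EdgeSet n} {i j vs} → Path Y i j vs → i ∈ vs
source∈ stop         = here refl
source∈ (step _ _ _) = here refl

target∈ : ∀ {n} {Y : EdgeSet n} {i j vs} → Path Y i j vs → j ∈ vs
target∈ stop         = here refl
target∈ (step _ _ p) = there (target∈ p)

-- In a tree given by parents, a path can go down only once it has stopped
-- going up, and from the root it cannot go up at all.
module _ {n : ℕ} (Y : EdgeSet n) (_◁_ _⊏_ : Rel (V n) 0ℓ)
  (adjacent⇒◁ : ∀ {i j} → Adjacent Y i j → i ◁ j ⊎ j ◁ i)
  (◁-unique : ∀ {i i′ j} → i ◁ j → i′ ◁ j → i ≡ i′)
  (◁-≢zero : ∀ {i} → ¬ i ◁ zero)
  (⊏-trans : Transitive _⊏_)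
  (◁⇒⊏ : ∀ {i j} → i ◁ j → i ⊏ j) where

  private
    path-descends : ∀ {i j vs} → Path Y i j vs → (∀ {h} → h ◁ i → h ∉ vs) → ∀ {x} → x ∈ vs → x ≡ j ⊎ x ⊏ j
    path-descends stop _ (here refl) = inj₁ refl
    path-descends (step {i} {k} {j} {vs} ik i∉ p) ¬up x∈ with adjacent⇒◁ ik
    ... | inj₂ k◁i = contradiction (there (source∈ p)) (¬up k◁i)
    ... | inj₁ i◁k = go x∈
      where
      rest : ∀ {x} → x ∈ vs → x ≡ j ⊎ x ⊏ j
      -- The only way up from `k` is back to `i`, which the path has already visited.
      rest = path-descends p λ h◁k h∈ → i∉ (subst (_∈ vs) (◁-unique h◁k i◁k) h∈)
      go : ∀ {x} → x ∈ i ∷ vs → x ≡ j ⊎ x ⊏ j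
      go (there x∈)  = rest x∈
      go (here refl) with rest (source∈ p)
      ... | inj₁ refl = inj₂ (◁⇒⊏ i◁k)
      ... | inj₂ k⊏j  = inj₂ (⊏-trans (◁⇒⊏ i◁k) k⊏j)

  precedes⇒⊏ : ∀ {i j} → Precedes Y i j → i ⊏ j
  precedes⇒⊏ (i≢j , _ , p , i∈) with path-descends p (λ h◁0 _ → ◁-≢zero h◁0) i∈
  ... | inj₁ i≡j = contradiction i≡j i≢j
  ... | inj₂ i⊏j = i⊏j

parent⇒precedes : ∀ {n} (T : EdgeSet n) {S i j} (g : Growth T S) → Parent T g i j → Precedes T i j
parent⇒precedes T (leaf g u∈ v∉ uv _) (inj₁ p)             = parent⇒precedes T g p
parent⇒precedes T (leaf g u∈ v∉ uv _) (inj₂ (refl , refl)) with growth-path T g (zero∈ T g) u∈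
... | _ , p , vs∈ = (λ { refl → v∉ u∈ }) , _ , path-snoc p uv (v∉ ∘ All.lookup vs∈) , ∈-++⁺ˡ (target∈ p)

-- The path tree of a permutation

inject₁<suc : ∀ {n} (k : Fin n) → inject₁ k < suc k
inject₁<suc k = Fin.≤̄⇒inject₁< {i = k} ℕ.≤-refl

module _ {n : ℕ} (s : Permutation′ n) where

  private
    π : V n → V n
    π = extend s ⟨$⟩ʳ_

    π⁻¹ : V n → V n
    π⁻¹ = extend s ⟨$⟩ˡ_

    π⁻¹∘π : ∀ {i} → π⁻¹ (π i) ≡ i
    π⁻¹∘π = inverseˡ (extend s)

    π∘π⁻¹ : ∀ {i} → π (π⁻¹ i) ≡ i
    π∘π⁻¹ = inverseʳ (extend s)

    π-injective : ∀ {i j} → π i ≡ π j → i ≡ j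
    π-injective eq = trans (sym π⁻¹∘π) (trans (cong π⁻¹ eq) π⁻¹∘π)

    π⁻¹-injective : ∀ {i j} → π⁻¹ i ≡ π⁻¹ j → i ≡ j
    π⁻¹-injective eq = trans (sym π∘π⁻¹) (trans (cong π eq) π∘π⁻¹)

  sequence : List (V n)
  sequence = tabulate π

  arc⁺ : ∀ {i j} → i < j → Arc s (π i) (π j)
  arc⁺ = subst₂ _<_ (sym π⁻¹∘π) (sym π⁻¹∘π)

  arc-isStrictTotalOrder : IsStrictTotalOrder _≡_ (Arc s)
  arc-isStrictTotalOrder = record
    { isStrictPartialOrder = record
      { isEquivalence = isEquivalence
      ; irrefl        = λ { refl → Fin.<-irrefl refl }
      ; trans         = Fin.<-trans
      ; <-resp-≈      = resp₂ (Arc s)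
      }
    ; compare = compare
    }
    where
    compare : ∀ i j → Tri (Arc s i j) (i ≡ j) (Arc s j i)
    compare i j with Fin.<-cmp (π⁻¹ i) (π⁻¹ j)
    ... | tri< lt ≢ ≯ = tri< lt (≢ ∘ cong π⁻¹) ≯
    ... | tri≈ ≮ eq ≯ = tri≈ ≮ (π⁻¹-injective eq) ≯
    ... | tri> ≮ ≢ gt = tri> ≮ (≢ ∘ cong π⁻¹) gt

  Consecutive : Rel (V n) 0ℓ
  Consecutive i j = ∃[ k ] i ≡ π (inject₁ k) × j ≡ π (suc k)

  adjacent⇒consecutive : ∀ {i j} → Adjacent (pathTree s) i j → Consecutive i j ⊎ Consecutive j i
  adjacent⇒consecutive (e , y , joins) with does-true (Fin.any? λ k → joins? e (π (inject₁ k)) (π (suc k))) y | joins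
  ... | k , inj₁ (refl , refl) | inj₁ (refl , refl) = inj₁ (k , refl , refl)
  ... | k , inj₁ (refl , refl) | inj₂ (refl , refl) = inj₂ (k , refl , refl)
  ... | k , inj₂ (refl , refl) | inj₁ (refl , refl) = inj₂ (k , refl , refl)
  ... | k , inj₂ (refl , refl) | inj₂ (refl , refl) = inj₁ (k , refl , refl)

  consecutive-adjacent : ∀ k → Adjacent (pathTree s) (π (inject₁ k)) (π (suc k))
  consecutive-adjacent k with Fin.<-cmp (π (inject₁ k)) (π (suc k))
  ... | tri< lt _ _ = edge _ _ lt , dec-true (Fin.any? _) (k , inj₁ (refl , refl)) , inj₁ (refl , refl)
  ... | tri> _ _ gt = edge _ _ gt , dec-true (Fin.any? _) (k , inj₂ (refl , refl)) , inj₂ (refl , refl)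
  ... | tri≈ _ eq _ = contradiction (π-injective eq) (Fin.<⇒≢ (inject₁<suc k))

  private
    -- The path visits exactly the positions up to `k`. One inclusion keeps the path simple when it
    -- is extended, the other gives `arc⇒precedes`.
    InitialPath : V n → Set
    InitialPath k = ∃[ vs ] Path (pathTree s) zero (π k) vs ×
      (∀ {x} → x ∈ vs → π⁻¹ x ≤ k) × (∀ {x} → π⁻¹ x ≤ k → x ∈ vs)

    initialPath : ∀ k → InitialPath k
    initialPath = <-weakInduction InitialPath base extendPath
      where
      base : InitialPath zero
      base = _ , stop , (λ { (here refl) → z≤n }) , λ { le → here (π⁻¹-injective (Fin.toℕ-injective (ℕ.n≤0⇒n≡0 le))) }

      extendPath : ∀ k → InitialPath (inject₁ k) → InitialPath (suc k)
      extendPath k (vs , p , sound , complete) = _ , path-snoc p (consecutive-adjacent k) fresh , sound′ , complete′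
        where
        fresh : π (suc k) ∉ vs
        fresh ∈vs = ℕ.<⇒≱ (inject₁<suc k) (subst (_≤ inject₁ k) π⁻¹∘π (sound ∈vs))
        sound′ : ∀ {x} → x ∈ vs ++ π (suc k) ∷ [] → π⁻¹ x ≤ suc k
        sound′ x∈ with ∈-++⁻ vs x∈
        ... | inj₁ x∈vs        = Fin.i≤inject₁[j]⇒i≤1+j (sound x∈vs)
        ... | inj₂ (here refl) = ℕ.≤-reflexive (cong toℕ π⁻¹∘π)
        complete′ : ∀ {x} → π⁻¹ x ≤ suc k → x ∈ vs ++ π (suc k) ∷ []
        complete′ {x} le with π⁻¹ x Fin.≟ suc k
        ... | yes eq = ∈-++⁺ʳ vs (here (trans (sym π∘π⁻¹) (cong π eq)))
        ... | no ≢   = ∈-++⁺ˡ (complete (ℕ.≤-trans (ℕ.s≤s⁻¹ (Fin.≤∧≢⇒< le ≢)) (ℕ.≤-reflexive (sym (Fin.toℕ-inject₁ k)))))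

  arc⇒precedes : ∀ {i j} → Arc s i j → Precedes (pathTree s) i j
  arc⇒precedes {i} {j} lt with initialPath (π⁻¹ j)
  ... | vs , p , _ , complete = (λ { refl → Fin.<-irrefl refl lt }) ,
    vs , subst (λ j → Path (pathTree s) zero j vs) π∘π⁻¹ p , complete (ℕ.<⇒≤ lt)

  -- In the path tree the parent of a vertex is its predecessor in the sequence.
  precedes⇒arc : ∀ {i j} → Precedes (pathTree s) i j → Arc s i j
  precedes⇒arc = precedes⇒⊏ (pathTree s) Consecutive (Arc s) adjacent⇒consecutive
    (λ { (k , refl , refl) (k′ , refl , eq) → cong (π ∘ inject₁) (Fin.suc-injective (π-injective eq)) })
    (λ { (k , _ , ()) })
    (IsStrictTotalOrder.trans arc-isStrictTotalOrder)
    (λ { (k , refl , refl) → arc⁺ (inject₁<suc k) })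

  module _ (T : EdgeSet n) {S} (g : Growth T S) (spans : ∀ i → i ∈ S) where

    -- A common extension contains the order of positions, because `pathTree s` already precedes
    -- along it. A parent behind its child would then be both above and below it.
    compatible⇒respecting : Compatible T (pathTree s) → AllPairs (λ x y → ¬ Parent T g y x) sequence
    compatible⇒respecting (_⊏_ , o , T⊆ , s⊆) = AllPairs.tabulate⁺-< λ a<b p →
      O.irrefl refl (O.trans (s⊆ (arc⇒precedes (arc⁺ a<b))) (T⊆ (parent⇒precedes T g p)))
      where module O = IsStrictTotalOrder o

    -- The order of positions itself is the common extension.
    respecting⇒compatible : AllPairs (λ x y → ¬ Parent T g y x) sequence → Compatible T (pathTree s)
    respecting⇒compatible ok = Arc s , arc-isStrictTotalOrder ,
      precedes⇒⊏ T (Parent T g) (Arc s) (λ a → adjacent-parent T g (spans _) (spans _) a) (parent-unique T g) (parent-≢zero T g)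
        (IsStrictTotalOrder.trans arc-isStrictTotalOrder) parent⇒arc ,
      precedes⇒arc
      where
      parent⇒arc : ∀ {i j} → Parent T g i j → Arc s i j
      parent⇒arc {i} {j} p with IsStrictTotalOrder.compare arc-isStrictTotalOrder i j
      ... | tri< lt _ _    = lt
      ... | tri≈ _ refl _  = contradiction refl (proj₁ (parent⇒precedes T g p))
      ... | tri> _ _ gt    = contradiction (subst₂ (Parent T g) (sym π∘π⁻¹) (sym π∘π⁻¹) p) (allPairs-tabulate⁻ {f = π} ok gt)

-- Permutations as sequences of vertices

unique-↭ : ∀ {a} {A : Set a} {xs ys : List A} → Unique xs → Unique ys →
           (∀ {x} → x ∈ xs → x ∈ ys) → (∀ {x} → x ∈ ys → x ∈ xs) → xs ↭ ys
unique-↭ xs! ys! ⊆ ⊇ = ∼bag⇒↭ (unique∧set⇒bag xs! ys! (mk⇔ ⊆ ⊇))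

module _ {n : ℕ} where

  sequence-unique : ∀ (s : Permutation′ n) → Unique (sequence s)
  sequence-unique s = Unique.tabulate⁺ λ eq →
    trans (sym (inverseˡ (extend s))) (trans (cong (extend s ⟨$⟩ˡ_) eq) (inverseˡ (extend s)))

  ∈-sequence : ∀ (s : Permutation′ n) i → i ∈ sequence s
  ∈-sequence s i = subst (_∈ sequence s) (inverseʳ (extend s)) (∈-tabulate⁺ {f = extend s ⟨$⟩ʳ_} (extend s ⟨$⟩ˡ i))

  sequence-cong : ∀ {s s′ : Permutation′ n} → s Perm.≈ s′ → sequence s ≡ sequence s′
  sequence-cong {s} {s′} eq = tabulate-cong (lift₀-cong s s′ eq)

  sequence-injective : ∀ {s s′ : Permutation′ n} → sequence s ≡ sequence s′ → s Perm.≈ s′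
  sequence-injective {s} {s′} eq i = Fin.suc-injective
    (Pointwise.tabulate⁻ {f = extend s ⟨$⟩ʳ_} {g = extend s′ ⟨$⟩ʳ_} (≡⇒Pointwise-≡ eq) (suc i))

  sequence-surjective : ∀ {w w₀} → Unique w → (∀ i → i ∈ w) → w ≡ zero ∷ w₀ → ∃[ s ] sequence s ≡ w
  sequence-surjective {w} w! all∈ w≡ with restrict ρ (trans (tabulate-lookup w) w≡)
    where
    ρ : Permutation (length w) (suc n)
    ρ = permutation (lookup w) (index ∘ all∈) (λ i → sym (lookup-index (all∈ i)))
          (λ k → lookup-injective w! (sym (lookup-index (all∈ (lookup w k)))))

    -- The length of `w` equals `suc n` only propositionally, so it is replaced by a variable `m`
    -- before being identified. Since position 0 holds the vertex 0, removing it and lifting again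
    -- gives back `ρ`.
    restrict : ∀ {m w₀} (ρ : Permutation m (suc n)) → tabulate (ρ ⟨$⟩ʳ_) ≡ zero ∷ w₀ →
               ∃[ s ] sequence s ≡ tabulate (ρ ⟨$⟩ʳ_)
    restrict ρ eq with refl ← ↔⇒≡ ρ = remove zero ρ , tabulate-cong (lift₀-remove ρ (∷-injectiveˡ eq))
  ... | s , eq = s , trans eq (tabulate-lookup w)

  module _ (T : EdgeSet n) {S} (g : Growth T S) (spans : ∀ i → i ∈ S)
    {ℓ} {P : Permutation′ n → Set ℓ} (P? : Decidable P)
    (P⇒respecting : ∀ {s} → P s → AllPairs (λ x y → ¬ Parent T g y x) (sequence s))
    (respecting⇒P : ∀ {s} → AllPairs (λ x y → ¬ Parent T g y x) (sequence s) → P s) where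

    -- Both lists are free of repetitions and have the same members, so sums over them agree.
    sequences-↭ : map sequence (filter P? (permutations n)) ↭ linearExtensions T g
    sequences-↭ = unique-↭
      (AllPairs.map⁺ (AllPairs.filter⁺ P?
        (AllPairs.map (λ {s} {s′} s≉s′ eq → s≉s′ (sequence-injective {s} {s′} eq)) (permutations-distinct n))))
      (linearExtensions-unique T g) to from
      where
      to : ∀ {w} → w ∈ map sequence (filter P? (permutations n)) → w ∈ linearExtensions T g
      to w∈ with ∈-map⁻ sequence w∈
      ... | s , s∈ , refl with ∈-filter⁻ P? {xs = permutations n} s∈
      ...   | _ , Ps = ∈-linearExtensions⁺ T g (isLinearExtension
        (unique-↭ (sequence-unique s) (growth-unique T g) (λ _ → spans _) (λ _ → ∈-sequence s _))
        (_ , refl) (P⇒respecting Ps))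

      from : ∀ {w} → w ∈ linearExtensions T g → w ∈ map sequence (filter P? (permutations n))
      from w∈ with ∈-linearExtensions⁻ T g w∈
      ... | isLinearExtension w↭ (_ , w≡) ok
        with sequence-surjective (unique-resp-↭ (↭-sym w↭) (growth-unique T g)) (λ i → ∈-resp-↭ (↭-sym w↭) (spans i)) w≡
      -- `permutations` contains `s` only up to pointwise equality; the copy `s′` has the same
      -- sequence.
      ...   | s , refl with find (permutations-complete s)
      ...     | s′ , s′∈ , s≈s′ = subst (_∈ map sequence (filter P? (permutations n))) (sym eq) (∈-map⁺ sequence
        (∈-filter⁺ P? s′∈ (respecting⇒P (subst (AllPairs _) eq ok))))
        where
        eq : sequence s ≡ sequence s′
        eq = sequence-cong {s} {s′} s≈s′

-- The expansion of p (∁ T)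

module Expansion {c ℓ} (R : CommutativeRing c ℓ) {n : ℕ} (t : V n → CommutativeRing.Carrier R) (T : EdgeSet n) where

  open CommutativeRing R hiding (zero) renaming (refl to ≈-refl; sym to ≈-sym; trans to ≈-trans)
  open RingProperties ring using (-‿distribˡ-*; -‿distribʳ-*; -‿involutive)
  open Exp semiring using (_^_)
  open SetoidReasoning setoid

  module ⨁ = BigOperator +-commutativeMonoid
  module ⨂ = BigOperator *-commutativeMonoid
  open ⨁ using () renaming (⨀ to ∑)
  open ⨂ using () renaming (⨀ to ∏; ⨀₂ to ∏₂)

  orientation : V n → V n → Carrier
  orientation x y = if does (x Fin.<? y) then 1# else - 1#

  orientation-anti : ∀ {x y} → x ≢ y → orientation y x ≈ - orientation x y
  orientation-anti {x} {y} x≢y with Fin.<-cmp x y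
  ... | tri< lt _ ≯ = ≈-trans (reflexive (if-no (y Fin.<? x) ≯))
    (-‿cong (reflexive (sym (if-yes (x Fin.<? y) lt))))
  ... | tri≈ _ eq _ = contradiction eq x≢y
  ... | tri> ≮ _ gt = ≈-trans (reflexive (if-yes (y Fin.<? x) gt))
    (≈-trans (≈-sym (-‿involutive 1#)) (-‿cong (reflexive (sym (if-no (x Fin.<? y) ≮)))))

  -- For α x y = t y - t x these are the factors of p (∁ T), for α = 1 their signs.
  offTree : (V n → V n → Carrier) → V n → V n → Carrier
  offTree α x y = if does (adjacent? T x y) then 1# else orientation x y * α x y

  offTree-adjacent : ∀ α {x y} → Adjacent T x y → offTree α x y ≈ 1#
  offTree-adjacent α {x} {y} a = reflexive (if-yes (adjacent? T x y) a)

  offTree-nonadjacent : ∀ α {x y} → ¬ Adjacent T x y → offTree α x y ≈ orientation x y * α x y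
  offTree-nonadjacent α {x} {y} ¬a = reflexive (if-no (adjacent? T x y) ¬a)

  -- The orientation and `α` both change sign, so the factor belongs to the unordered pair. This
  -- lets products over pairs be reordered by `⨀₂-↭`.
  offTree-sym : ∀ α → (∀ {x y} → x ≢ y → α y x ≈ - α x y) → ∀ x y → offTree α x y ≈ offTree α y x
  offTree-sym α anti x y with x Fin.≟ y
  ... | yes refl = ≈-refl
  ... | no x≢y = by-adjacency (adjacent? T y x)
    where
    by-adjacency : Dec (Adjacent T y x) → offTree α x y ≈ offTree α y x
    by-adjacency (yes a) = ≈-trans (offTree-adjacent α (adjacent-sym T a)) (≈-sym (offTree-adjacent α a))
    by-adjacency (no ¬a) = begin
      offTree α x y                     ≈⟨ offTree-nonadjacent α (¬a ∘ adjacent-sym T) ⟩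
      orientation x y * α x y           ≈⟨ -‿involutive _ ⟨
      - - (orientation x y * α x y)     ≈⟨ -‿cong (-‿distribʳ-* _ _) ⟩
      - (orientation x y * - α x y)     ≈⟨ -‿distribˡ-* _ _ ⟩
      - orientation x y * - α x y       ≈⟨ *-cong (orientation-anti x≢y) (anti x≢y) ⟨
      orientation y x * α y x           ≈⟨ offTree-nonadjacent α ¬a ⟨
      offTree α y x                     ∎

  open LeafInsertion R (Fin._≟_ {suc n}) t (offTree λ _ _ → 1#) (offTree λ x y → t y - t x)
    using (d; d-anti; gaps; term; Detached; ∑-insertionsAfter; *-distribˡ-∑)

  φ : V n → V n → Carrier
  φ = offTree d

  φ-sym : ∀ x y → φ x y ≈ φ y x
  φ-sym = offTree-sym d (λ _ → d-anti _ _)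

  detached : ∀ {v x} → x ≢ v → ¬ Adjacent T x v → Detached v x
  detached {v} {x} x≢v ¬a = record
    { ε-anti = begin
        offTree (λ _ _ → 1#) v x     ≈⟨ offTree-nonadjacent _ (¬a ∘ adjacent-sym T) ⟩
        orientation v x * 1#         ≈⟨ *-congʳ (orientation-anti x≢v) ⟩
        - orientation x v * 1#       ≈⟨ -‿distribˡ-* _ _ ⟨
        - (orientation x v * 1#)     ≈⟨ -‿cong (offTree-nonadjacent _ ¬a) ⟨
        - offTree (λ _ _ → 1#) x v   ∎
    ; φ≈ = ≈-trans (offTree-nonadjacent d ¬a)
        (*-congʳ (≈-sym (≈-trans (offTree-nonadjacent _ ¬a) (*-identityʳ _))))
    }

  -- The pairs in `v ∷ S` are those with `v` and those inside `S`. Summing over the insertions of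
  -- `v` multiplies each term by the product over the former, whatever order `w` puts `S` in;
  -- induction gives the latter.
  ∑-linearExtensions : ∀ {S} (g : Growth T S) → ∑ (linearExtensions T g) term ≈ ∏₂ S φ
  ∑-linearExtensions root = ≈-trans (+-identityʳ _) (≈-trans (*-congˡ (*-identityʳ 1#)) (*-identityʳ _))
  ∑-linearExtensions (leaf {S} {u} {v} g u∈ v∉ uv !u) = begin
    ∑ (concatMap (insertionsAfter Fin._≟_ u v) L) term
      ≈⟨ ⨁.⨀-concatMap (insertionsAfter Fin._≟_ u v) L term ⟩
    ∑ L (λ w → ∑ (insertionsAfter Fin._≟_ u v w) term)
      ≈⟨ ⨁.⨀-cong {xs = L} (All.tabulate λ {w} w∈ → insert-leaf w (arranges (∈-linearExtensions⁻ T g w∈))) ⟩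
    ∑ L (λ w → ∏ S (φ v) * term w)
      ≈⟨ *-distribˡ-∑ _ L term ⟩
    ∏ S (φ v) * ∑ L term
      ≈⟨ *-congˡ (∑-linearExtensions g) ⟩
    ∏ S (φ v) * ∏₂ S φ ∎
    where
    L = linearExtensions T g

    insert-leaf : ∀ w → w ↭ S → ∑ (insertionsAfter Fin._≟_ u v w) term ≈ ∏ S (φ v) * term w
    insert-leaf w w↭ = begin
      ∑ (insertionsAfter Fin._≟_ u v w) term
        ≈⟨ ∑-insertionsAfter w (∈-resp-↭ (↭-sym w↭) u∈) (unique-resp-↭ (↭-sym w↭) (growth-unique T g))
             (offTree-adjacent _ uv) (offTree-adjacent d uv)
             (λ x∈ x≢u → detached (λ { refl → v∉ (∈-resp-↭ w↭ x∈) }) (x≢u ∘ !u (∈-resp-↭ w↭ x∈))) ⟩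
      term w * ∏ w (λ x → φ x v)
        ≈⟨ *-comm _ _ ⟩
      ∏ w (λ x → φ x v) * term w
        ≈⟨ *-congʳ (≈-trans (⨂.⨀-cong {xs = w} (All.tabulate λ _ → φ-sym _ v)) (⨂.⨀-↭ (φ v) w↭)) ⟩
      ∏ S (φ v) * term w ∎

  -- The two polynomials and the sign as products over pairs

  separated : ∀ {m} → (Fin m → V n) → Fin m → Fin m → Carrier
  separated f i j = if does (¬? (toℕ j ℕ.≟ suc (toℕ i))) then d (f i) (f j) else 1#

  gaps-tabulate : ∀ {m} (f : Fin m → V n) → ∏₂ (allFin m) (separated f) ≈ gaps (tabulate f)
  gaps-tabulate {zero}  f = ≈-refl
  gaps-tabulate {suc m} f = *-cong (row f)
    (≈-trans (⨂.⨀₂-tabulate-cong Fin.suc id {separated f} {separated (f ∘ suc)} (λ i j → ≈-refl)) (gaps-tabulate (f ∘ suc)))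
    where
    row : ∀ {m} (f : Fin (suc m) → V n) →
      ∏ (tabulate suc) (separated f zero) ≈ ∏ (drop 1 (tabulate (f ∘ suc))) (d (f zero))
    row {zero}  f = ≈-refl
    -- Position 1 is consecutive to position 0 and contributes 1, matching `drop 1` in `gaps`; all
    -- later positions pass the test by computation.
    row {suc m} f = ≈-trans (*-identityˡ _) (⨂.⨀-tabulate-cong (Fin.suc ∘ Fin.suc) (f ∘ Fin.suc ∘ Fin.suc) (λ _ → ≈-refl))

  ∏-nonConsecutive : ∀ s → ∏ (nonConsecutive n) (λ e → d (extend s ⟨$⟩ʳ tail e) (extend s ⟨$⟩ʳ head e)) ≈ gaps (sequence s)
  ∏-nonConsecutive s = ≈-trans (⨂.⨀-filter _ (edges n) _)
    (≈-trans (⨂.⨀-edges n (separated (extend s ⟨$⟩ʳ_)))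
      (gaps-tabulate (extend s ⟨$⟩ʳ_)))

  -- Edges of the tree become factors 1, and along an edge from tail to head the orientation is 1.
  -- With `d` for `α` this treats `p (∁ T)`, with `arcSign` the sign.
  ∏-∁ : ∀ (f : Edge n → Carrier) α → (∀ e → f e ≈ α (tail e) (head e)) →
        ∏ (elements (∁ T)) f ≈ ∏₂ (allFin (suc n)) (offTree α)
  ∏-∁ f α f≈α = ≈-trans (⨂.⨀-filter _ (edges n) f)
    (≈-trans (⨂.⨀-cong {xs = edges n} (All.tabulate λ {e} _ → pointwise e)) (⨂.⨀-edges n (offTree α)))
    where
    pointwise : ∀ e → (if does (∁ T e Bool.≟ true) then f e else 1#) ≈ offTree α (tail e) (head e)
    pointwise e@(edge i j i<j) with T e in eq
    ... | true  = ≈-sym (offTree-adjacent α (e , eq , inj₁ (refl , refl)))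
    ... | false = ≈-trans (f≈α e) (≈-sym (≈-trans (offTree-nonadjacent α ¬adjacent)
        (≈-trans (*-congʳ (reflexive (if-yes (i Fin.<? j) i<j′))) (*-identityˡ _))))
      where
      i<j′ : i < j
      i<j′ = recompute (i Fin.<? j) i<j
      ¬adjacent : ¬ Adjacent T i j
      ¬adjacent (e′ , y , inj₁ (refl , refl)) = contradiction (trans (sym y) eq) λ ()
      ¬adjacent (edge _ _ j<i , y , inj₂ (refl , refl)) = Fin.<-asym i<j′ (recompute (j Fin.<? i) j<i)

  sign^length : ∀ {a} {A : Set a} (xs : List A) → (- 1#) ^ length xs ≈ ∏ xs (λ _ → - 1#)
  sign^length []       = ≈-refl
  sign^length (x ∷ xs) = *-congˡ (sign^length xs)

  module _ (s : Permutation′ n) where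

    arcSign : V n → V n → Carrier
    arcSign x y = if does (arc? s y x) then - 1# else 1#

    arcSign⁺ : ∀ {x y} → Arc s x y → arcSign x y ≈ 1#
    arcSign⁺ {x} {y} lt = reflexive (if-no (arc? s y x) (Fin.<-asym lt))

    arcSign⁻ : ∀ {x y} → Arc s y x → arcSign x y ≈ - 1#
    arcSign⁻ {x} {y} gt = reflexive (if-yes (arc? s y x) gt)

    arcSign-anti : ∀ {x y} → x ≢ y → arcSign y x ≈ - arcSign x y
    arcSign-anti {x} {y} x≢y with compare x y
      where open IsStrictTotalOrder (arc-isStrictTotalOrder s) using (compare)
    ... | tri< lt _ _ = ≈-trans (arcSign⁻ lt) (-‿cong (≈-sym (arcSign⁺ lt)))
    ... | tri≈ _ eq _ = contradiction eq x≢y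
    ... | tri> _ _ gt = ≈-trans (arcSign⁺ gt) (≈-trans (≈-sym (-‿involutive 1#)) (-‿cong (≈-sym (arcSign⁻ gt))))

    -- The power is a product of `arcSign` over the edges off the tree. Made symmetric by the
    -- orientation, it can be reordered along `sequence s`; there every arc points forward,
    -- `arcSign` is 1, and only the orientation remains.
    ^mm : (- 1#) ^ mm (∁ T) s ≈ ∏₂ (sequence s) (offTree λ _ _ → 1#)
    ^mm = begin
      (- 1#) ^ mm (∁ T) s
        ≈⟨ sign^length (filter (λ e → arc? s (head e) (tail e)) (elements (∁ T))) ⟩
      ∏ (filter (λ e → arc? s (head e) (tail e)) (elements (∁ T))) (λ _ → - 1#)
        ≈⟨ ⨂.⨀-filter _ (elements (∁ T)) _ ⟩
      ∏ (elements (∁ T)) (λ e → arcSign (tail e) (head e))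
        ≈⟨ ∏-∁ _ arcSign (λ _ → ≈-refl) ⟩
      ∏₂ (allFin (suc n)) (offTree arcSign)
        ≈⟨ ⨂.⨀₂-↭ (offTree-sym arcSign arcSign-anti)
             (unique-↭ (Unique.allFin⁺ (suc n)) (sequence-unique s) (λ _ → ∈-sequence s _) (λ _ → ∈-allFin _)) ⟩
      ∏₂ (sequence s) (offTree arcSign)
        ≈⟨ ⨂.⨀₂-cong {xs = sequence s} (AllPairs.tabulate⁺-< {f = π} λ {i} {j} i<j → offTree-cong {π i} {π j} (arcSign⁺ (arc⁺ s i<j))) ⟩
      ∏₂ (sequence s) (offTree λ _ _ → 1#) ∎
      where
      π = extend s ⟨$⟩ʳ_

      offTree-cong : ∀ {x y} → arcSign x y ≈ 1# → offTree arcSign x y ≈ offTree (λ _ _ → 1#) x y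
      offTree-cong {x} {y} eq with does (adjacent? T x y)
      ... | true  = ≈-refl
      ... | false = *-congˡ eq

  -- The outcome of the compatibility test is an argument, so that `summand≈term` can split on it
  -- without involving `compatible?`.
  summand : Permutation′ n → Bool → Carrier
  summand s b = (- 1#) ^ mm (∁ T) s * (if b then 1# else 0#) *
    ∏ (nonConsecutive n) (λ e → t (extend s ⟨$⟩ʳ head e) - t (extend s ⟨$⟩ʳ tail e))

  summand≈term : ∀ s b → summand s b ≈ (if b then term (sequence s) else 0#)
  summand≈term s true  = *-cong (≈-trans (*-identityʳ _) (^mm s)) (∏-nonConsecutive s)
  summand≈term s false = ≈-trans (*-congʳ (zeroʳ _)) (zeroˡ _)

  -- P s is Compatible T (pathTree s), kept abstract because unfolding
  -- compatible? is expensive.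
  module _ {a} {P : Permutation′ n → Set a} (P? : Decidable P) {S} (g : Growth T S) (spans : ∀ i → i ∈ S)
    (P⇒respecting : ∀ {s} → P s → AllPairs (λ x y → ¬ Parent T g y x) (sequence s))
    (respecting⇒P : ∀ {s} → AllPairs (λ x y → ¬ Parent T g y x) (sequence s) → P s) where

    growth-expansion : ∏ (elements (∁ T)) (λ e → t (head e) - t (tail e)) ≈
                       ∑ (permutations n) (λ s → summand s (does (P? s)))
    growth-expansion = begin
      ∏ (elements (∁ T)) (λ e → t (head e) - t (tail e))
        ≈⟨ ∏-∁ _ d (λ _ → ≈-refl) ⟩
      ∏₂ (allFin (suc n)) φ
        ≈⟨ ⨂.⨀₂-↭ φ-sym (unique-↭ (growth-unique T g) (Unique.allFin⁺ (suc n)) (λ _ → ∈-allFin _) (λ _ → spans _)) ⟨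
      ∏₂ S φ
        ≈⟨ ∑-linearExtensions g ⟨
      ∑ (linearExtensions T g) term
        ≈⟨ ⨁.⨀-↭ term (sequences-↭ T g spans P? P⇒respecting respecting⇒P) ⟨
      ∑ (map sequence (filter P? (permutations n))) term
        ≈⟨ ⨁.⨀-map sequence (filter P? (permutations n)) term ⟩
      ∑ (filter P? (permutations n)) (term ∘ sequence)
        ≈⟨ ⨁.⨀-filter P? (permutations n) (term ∘ sequence) ⟩
      ∑ (permutations n) (λ s → if does (P? s) then term (sequence s) else 0#)
        ≈⟨ ⨁.⨀-cong {xs = permutations n} (All.tabulate λ {s} _ → summand≈term s (does (P? s))) ⟨
      ∑ (permutations n) (λ s → summand s (does (P? s))) ∎

  expansion : IsSpanningTree T →
    ∏ (elements (∁ T)) (λ e → t (head e) - t (tail e)) ≈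
    ∑ (permutations n) (λ s → summand s (does (compatible? T (pathTree s))))
  expansion tree = let S , g , spans = spanning-growth T tree in
    growth-expansion (λ s → compatible? T (pathTree s)) g spans
      (λ {s} → compatible⇒respecting s T g spans) (λ {s} → respecting⇒compatible s T g spans)

theorem3p3 : ∀ {c ℓ} (K : CommutativeRing c ℓ) (n : ℕ) (T : EdgeSet n) → IsSpanningTree T →
    let open Polynomial K n in
    p (∁ T) ≈ ∑ (permutations n) (λ s → (- 1#) ^ mm (∁ T) s * C T (pathTree s) * 𝐏 s)
theorem3p3 K n T = Expansion.expansion (Polynomial.K[t] K n) (Polynomial.t K n) T
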